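{- There exist an oracle $B \subseteq \{0,1\}^*$ and a set $A \subseteq \{0,1\}^*$ such that $A$ is $\leqslant^{\mathrm{P}}_{2-\mathrm{T}}$-complete for $\mathrm{EXP}^B$, but $A$ is not autoreducible relative to $B$; that is, there is no deterministic polynomial-time oracle Turing machine $M$ with access to both $B$ and a second oracle such that $M$ with oracles $B$ and $A$ decides $A$ and, for any input $x$ and any second oracle, $M$ on input $x$ does not query $x$ to the second oracle.
   Context: $\mathrm{EXP}^B$ is the class of sets decidable by deterministic oracle Turing machines with oracle $B$ running in time $2^{n^{O(1)}}$ (queries to $B$ may be exponentially long). We write $D \leqslant^{\mathrm{P}}_{2-\mathrm{T}} A$ if there is a deterministic polynomial-time oracle Turing machine $M$ such that $M^A$ decides $D$ and $M$ makes at most 2 (possibly adaptive) oracle queries on every input. A set $A$ is $\leqslant^{\mathrm{P}}_{2-\mathrm{T}}$-complete for a class $\mathcal{C}$ if $A \in \mathcal{C}$ and every set $D \in \mathcal{C}$ satisfies $D \leqslant^{\mathrm{P}}_{2-\mathrm{T}} A$. -}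

module Defs where

open import Data.Bool using (Bool; true; false; if_then_else_)
open import Data.Fin using (Fin; zero; suc; _↑ˡ_)
open import Data.List using (List; []; _∷_; length)
open import Data.Nat using (ℕ; zero; suc; _+_; _^_; _≤_)
open import Data.Product using (_×_; _,_; ∃-syntax)
open import Data.Vec using (Vec; []; _∷_; lookup; map; replicate; zipWith)
open import Level using (0ℓ)
open import Relation.Binary.PropositionalEquality using (_≡_)
open import Relation.Nullary using (¬_)
open import Relation.Unary using (Pred; _∈_)

Word : Set
Word = List Bool

-- Subsets of {0,1}* are given by their characteristic functions, both as
-- languages and as oracles.
Language : Set
Language = Word → Bool

Class : Set₁
Class = Pred Language 0ℓ

data Symbol (g : ℕ) : Set where
  blank : Symbol g
  bit   : Bool → Symbol g
  mark  : Fin g → Symbol g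

data Move : Set where
  left stay right : Move

-- A two-way infinite tape.  `before` lists the cells to the left of the head,
-- nearest first; `after` lists those to its right; all other cells are blank.
record Tape (g : ℕ) : Set where
  constructor tape
  field
    before  : List (Symbol g)
    scanned : Symbol g
    after   : List (Symbol g)

open Tape public

module _ {g : ℕ} where

  emptyTape : Tape g
  emptyTape = tape [] blank []

  inputTape : Word → Tape g
  inputTape []      = emptyTape
  inputTape (b ∷ w) = tape [] (bit b) (Data.List.map bit w)

  moveHead : Move → Tape g → Tape g
  moveHead stay  t                   = t
  moveHead left  (tape []       s r) = tape [] blank (s ∷ r)
  moveHead left  (tape (a ∷ l)  s r) = tape l a (s ∷ r)
  moveHead right (tape l s [])       = tape (s ∷ l) blank []
  moveHead right (tape l s (a ∷ r))  = tape (s ∷ l) a r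

  writeMove : Symbol g × Move → Tape g → Tape g
  writeMove (s , d) t = moveHead d (record t { scanned = s })

  leadingBits : List (Symbol g) → Word
  leadingBits (bit b ∷ ss) = b ∷ leadingBits ss
  leadingBits _            = []

  -- The word starting at the head and extending to the right up to, but not
  -- including, the first cell that does not hold a bit.
  wordAtHead : Tape g → Word
  wordAtHead t = leadingBits (scanned t ∷ after t)

data Action (oracles states tapes marks : ℕ) : Set where
  continue : Fin states → Vec (Symbol marks × Move) tapes →
             Action oracles states tapes marks
  query    : Fin oracles → (ifYes ifNo : Fin states) →
             Action oracles states tapes marks
  halt     : Bool → Action oracles states tapes marks

-- Deterministic multitape Turing machines with access to m oracles.  Tape 0
-- initially holds the input, tapes 1, …, m are the query tapes of the
-- respective oracles, and the remaining ones are work tapes.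
record OracleTM (m : ℕ) : Set where
  field
    states workTapes marks : ℕ

  tapes : ℕ
  tapes = suc (m + workTapes)

  field
    start : Fin states
    δ     : Fin states → Vec (Symbol marks) tapes →
            Action m states tapes marks

  queryTape : Fin m → Fin tapes
  queryTape i = suc (i ↑ˡ workTapes)

module _ {m : ℕ} (M : OracleTM m) where
  open OracleTM M

  record Config : Set where
    constructor config
    field
      state    : Fin states
      contents : Vec (Tape marks) tapes

  open Config

  initial : Word → Config
  initial x = config start (inputTape x ∷ replicate _ emptyTape)

  nextAction : Config → Action m states tapes marks
  nextAction c = δ (state c) (map scanned (contents c))

  queryWord : Fin m → Config → Word
  queryWord i c = wordAtHead (lookup (contents c) (queryTape i))

  perform : Vec Language m → Action m states tapes marks → Config → Config
  perform O (continue q ws)   c = config q (zipWith writeMove ws (contents c))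
  perform O (query i yes no) c =
    record c { state = if lookup O i (queryWord i c) then yes else no }
  perform O (halt _)         c = c

  step : Vec Language m → Config → Config
  step O c = perform O (nextAction c) c

  -- The configuration after t steps; halting configurations are repeated forever.
  configAt : Vec Language m → Word → ℕ → Config
  configAt O x zero    = initial x
  configAt O x (suc t) = step O (configAt O x t)

  HaltsAt : Vec Language m → Word → ℕ → Bool → Set
  HaltsAt O x t b = nextAction (configAt O x t) ≡ halt b

  RunsInTime : Vec Language m → (ℕ → ℕ) → Set
  RunsInTime O f = ∀ x → ∃[ b ] HaltsAt O x (f (length x)) b

  Decides : Vec Language m → Language → Set
  Decides O D = ∀ x → ∃[ t ] HaltsAt O x t (D x)

  Queries : Vec Language m → Word → Fin m → Word → Set
  Queries O x i w =
    ∃[ t ] ∃[ yes ] ∃[ no ]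
      (nextAction (configAt O x t) ≡ query i yes no ×
       queryWord i (configAt O x t) ≡ w)

  isQuery : Action m states tapes marks → ℕ
  isQuery (query _ _ _) = 1
  isQuery _             = 0

  -- The number of queries, counted with multiplicity, in the first t steps.
  queryCount : Vec Language m → Word → ℕ → ℕ
  queryCount O x zero    = 0
  queryCount O x (suc t) =
    queryCount O x t + isQuery (nextAction (configAt O x t))

-- Every polynomial is bounded on ℕ by n ^ k + k for some k.
polyBound : ℕ → ℕ → ℕ
polyBound k n = n ^ k + k

expBound : ℕ → ℕ → ℕ
expBound k n = 2 ^ polyBound k n

EXP : Language → Class
EXP B D = ∃[ M ] ∃[ k ]
  (RunsInTime {1} M (B ∷ []) (expBound k) × Decides M (B ∷ []) D)

-- The time and query bounds are properties of the machine: they hold for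
-- every oracle.
_≤ᴾ₂₋ᵀ_ : Language → Language → Set
D ≤ᴾ₂₋ᵀ A = ∃[ M ]
  ((∃[ k ] ∀ X → RunsInTime {1} M (X ∷ []) (polyBound k)) ×
   (∀ X x t → queryCount M (X ∷ []) x t ≤ 2) ×
   Decides M (A ∷ []) D)

Complete₂₋ᵀ : Language → Class → Set
Complete₂₋ᵀ A C = A ∈ C × (∀ D → D ∈ C → D ≤ᴾ₂₋ᵀ A)

-- The first oracle is fixed to B; the time bound and the ban on querying the
-- input hold for every second oracle.
AutoreducibleRelativeTo : Language → Language → Set
AutoreducibleRelativeTo B A = ∃[ M ]
  ((∃[ k ] ∀ X → RunsInTime {2} M (B ∷ X ∷ []) (polyBound k)) ×
   Decides M (B ∷ A ∷ []) A ×
   (∀ X x → ¬ Queries M (B ∷ X ∷ []) x (suc zero) x))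

{-# OPTIONS --safe #-}
module Submission where

-- Worlds β : ℕ → Bool parametrise the construction.  In the world β, the set A
-- answers β m on true^m, and on a request ⟨c, N, e, x⟩ it answers what machine e
-- does on x within 2^N steps in the world where the bit at the last threshold
-- cur N ≤ N has been changed to c.  The oracle B stores A at exponentially padded
-- words, so A ∈ EXP^B, and an EXP^B computation is decided with two queries to A:
-- first c = β (cur N), then ⟨c, N, e, x⟩.  Since A answers such requests for both
-- values of c, nothing short except true^m itself depends on the bit at a
-- threshold m, and a polynomial-time machine cannot reach the padded words that
-- do.  Hence the bits at successive thresholds can be chosen to defeat one
-- candidate autoreduction each.  The thresholds grow faster than any polynomial
-- but can be found in linear time by counting.

open import Data.Bool using (Bool; true; false; if_then_else_; not)
open import Data.Bool.Properties using (not-¬)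
open import Data.Fin using (Fin; zero; suc; _↑ˡ_; _↑ʳ_; splitAt)
open import Data.Fin.Patterns
open import Data.Fin.Properties using (splitAt-↑ˡ; splitAt-↑ʳ)
open import Data.List using (List; []; _∷_; length; _++_; reverse; _ʳ++_)
import Data.List as List
open import Data.List.Properties using (length-replicate; length-++; length-reverse; reverse-involutive)
open import Data.Maybe using (Maybe; just; nothing)
open import Data.Nat
open import Data.Nat.Properties
open import Data.Product using (_×_; _,_; ∃-syntax; proj₁; proj₂; uncurry)
open import Data.Sum using (inj₁; inj₂; [_,_]′)
open import Data.Vec using (Vec; []; _∷_; lookup; map; replicate; zipWith; _[_]%=_; _[_]≔_)
open import Data.Vec.Properties using (lookup-zipWith; lookup-replicate; lookup-map; map-updateAt; updateAt-updateAt; map-replicate)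
open import Function using (_∘_; const)
open import Relation.Binary.PropositionalEquality
open import Relation.Nullary using (¬_; yes; no; does; contradiction)
open import Relation.Nullary.Decidable using (dec-true; dec-false)
open import Relation.Unary using (_∈_)
open import Defs

-- Runs of oracle machines

-- The masking covers only the last threshold: a request with `N` past the next one reads the
-- earlier bit unmasked and may reveal it. This forces the gaps between thresholds, since every word
-- that a candidate can write on true^m must be shorter than the next threshold. Masking earlier
-- thresholds as well would force the reduction to ask for their bits too. `A` and `B` refer to each
-- other, and lengths make this well-founded: within 2^N steps only words of length at most 2^N are
-- queried, a request is longer than `N`, and its form in `B` is exponentially longer still. The
-- same count shows that a word of `B` of length at most 2^L depends only on bits up to `L`, so time
-- 2^(m-1) cannot reach bit `m` through `B`, while it exceeds any given polynomial once the
-- threshold `m` is large. Each machine therefore has to occur at arbitrarily large stages. The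
-- reduction has to find thresholds by itself, in polynomial time under every oracle, so they come
-- from counters and not from the diagonalisation.

accepts : ∀ {m s T g} → Action m s T g → Bool
accepts (halt b) = b
accepts _        = false

-- Total by convention: a run that has not halted counts as rejecting, so every index and every time
-- bound yields a bit.
outcome : ∀ {m} → OracleTM m → Vec Language m → Word → ℕ → Bool
outcome M O x t = accepts (nextAction M (configAt M O x t))

visited : ∀ {g} → Tape g → ℕ
visited t = length (before t) + length (after t)

visited-writeMove : ∀ {g} a (t : Tape g) → visited (writeMove a t) ≤ suc (visited t)
visited-writeMove (s , stay)  (tape l       _ r)       = n≤1+n _
visited-writeMove (s , left)  (tape []      _ r)       = ≤-refl
visited-writeMove (s , left)  (tape (_ ∷ l) _ r)       = ≤-trans (≤-reflexive (+-suc (length l) (length r))) (n≤1+n _)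
visited-writeMove (s , right) (tape l       _ [])      = ≤-refl
visited-writeMove (s , right) (tape l       _ (_ ∷ r)) = s≤s (+-monoʳ-≤ (length l) (n≤1+n _))

length-leadingBits : ∀ {g} (ss : List (Symbol g)) → length (leadingBits ss) ≤ length ss
length-leadingBits []             = z≤n
length-leadingBits (blank ∷ ss)   = z≤n
length-leadingBits (bit b ∷ ss)   = s≤s (length-leadingBits ss)
length-leadingBits (mark _ ∷ ss)  = z≤n

module _ {m : ℕ} (M : OracleTM m) where
  open OracleTM M

  visited-perform : ∀ O a (c : Config M) j →
    visited (lookup (Config.contents (perform M O a c)) j) ≤
    suc (visited (lookup (Config.contents c) j))
  visited-perform O (continue q ws) c j
    rewrite lookup-zipWith writeMove j ws (Config.contents c) =
    visited-writeMove (lookup ws j) (lookup (Config.contents c) j)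
  visited-perform O (query _ _ _) c j = n≤1+n _
  visited-perform O (halt _)      c j = n≤1+n _

  visited-queryTape : ∀ O x t i →
    visited (lookup (Config.contents (configAt M O x t)) (queryTape i)) ≤ t
  visited-queryTape O x zero i
    rewrite lookup-replicate (i ↑ˡ workTapes) (emptyTape {marks}) = z≤n
  visited-queryTape O x (suc t) i =
    ≤-trans (visited-perform O (nextAction M (configAt M O x t)) (configAt M O x t) (queryTape i))
            (s≤s (visited-queryTape O x t i))

  -- Query tapes start empty and grow by at most one cell per step, so the bound does not involve
  -- the input; the extra one is the scanned cell.
  length-queryWord : ∀ O x t i → length (queryWord M i (configAt M O x t)) ≤ suc t
  length-queryWord O x t i =
    ≤-trans (length-leadingBits (scanned q ∷ after q))
            (s≤s (≤-trans (m≤n+m _ _) (visited-queryTape O x t i)))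
    where q = lookup (Config.contents (configAt M O x t)) (queryTape i)

  -- Agreement is demanded only on words that the run with `O` really asks, which is where the ban
  -- on querying the input can enter, and only up to length `T`, which is where locality of the
  -- oracles can.
  configAt-cong : ∀ O O′ x T →
    (∀ i w → Queries M O x i w → length w ≤ T → lookup O i w ≡ lookup O′ i w) →
    ∀ t → t ≤ T → configAt M O x t ≡ configAt M O′ x t
  configAt-cong O O′ x T agree zero    _   = refl
  configAt-cong O O′ x T agree (suc t) t<T
    rewrite sym (configAt-cong O O′ x T agree t (<⇒≤ t<T))
    with nextAction M (configAt M O x t) in eq
  ... | continue _ _    = refl
  ... | halt _          = refl
  ... | query i y n  =
    cong (λ b → config (if b then y else n) (Config.contents (configAt M O x t)))
         (agree i _ (t , y , n , eq , refl)
                (≤-trans (length-queryWord O x t i) t<T))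

  outcome-cong : ∀ O O′ x T →
    (∀ i w → Queries M O x i w → length w ≤ T → lookup O i w ≡ lookup O′ i w) →
    outcome M O x T ≡ outcome M O′ x T
  outcome-cong O O′ x T agree =
    cong (accepts ∘ nextAction M) (configAt-cong O O′ x T agree T ≤-refl)

  module _ (O : Vec Language m) (x : Word) where

    halted-step : ∀ t {b} → HaltsAt M O x t b → HaltsAt M O x (suc t) b
    halted-step t h rewrite h = h

    halts-later : ∀ {t u b} → t ≤ u → HaltsAt M O x t b → HaltsAt M O x u b
    halts-later {t} {b = b} t≤u h = go (≤⇒≤′ t≤u)
      where
      go : ∀ {u} → t ≤′ u → HaltsAt M O x u b
      go ≤′-refl         = h
      go (≤′-step {u} q) = halted-step u (go q)

    halts⇒outcome : ∀ t u {b} → t ≤ u → HaltsAt M O x t b → outcome M O x u ≡ b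
    halts⇒outcome t u t≤u h = cong accepts (halts-later {t} {u} t≤u h)

    -- `Decides` supplies a halting time unrelated to the time bound; halting configurations
    -- persist, so both times show the same verdict.
    decided-outcome : ∀ t u {a b} → HaltsAt M O x t a → HaltsAt M O x u b → outcome M O x t ≡ b
    decided-outcome t u p q with ≤-total t u
    ... | inj₁ t≤u = trans (halts⇒outcome t t ≤-refl p)
                           (trans (sym (halts⇒outcome t u t≤u p)) (halts⇒outcome u u ≤-refl q))
    ... | inj₂ u≤t = halts⇒outcome u t u≤t q

pattern machine s w g q₀ d =
  record { states = s ; workTapes = w ; marks = g ; start = q₀ ; δ = d }

-- Without function extensionality, machines can be enumerated only up to
-- pointwise equality of their transition functions.
data _≈_ {m : ℕ} : OracleTM m → OracleTM m → Set where
  same : ∀ {s w g q₀ d d′} → (∀ q v → d q v ≡ d′ q v) →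
         machine s w g q₀ d ≈ machine s w g q₀ d′

module _ {m s w g : ℕ} {q₀ : Fin s}
         {d d′ : Fin s → Vec (Symbol g) (suc (m + w)) → Action m s (suc (m + w)) g}
         (d≗d′ : ∀ q v → d q v ≡ d′ q v) (O : Vec Language m) (x : Word) where

  private
    M M′ : OracleTM m
    M  = machine s w g q₀ d
    M′ = machine s w g q₀ d′

  -- Configurations are indexed by the machine, so runs of `M` and `M′` live in different types
  -- although their fields coincide.
  copy : Config M → Config M′
  copy (config q ts) = config q ts

  copy-perform : ∀ a (c : Config M) → copy (perform M O a c) ≡ perform M′ O a (copy c)
  copy-perform (continue _ _) c = refl
  copy-perform (query _ _ _)  c = refl
  copy-perform (halt _)       c = refl

  nextAction-copy : ∀ c → nextAction M c ≡ nextAction M′ (copy c)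
  nextAction-copy c = d≗d′ _ _

  copy-configAt : ∀ t → copy (configAt M O x t) ≡ configAt M′ O x t
  copy-configAt zero    = refl
  copy-configAt (suc t) = begin
    copy (perform M O (nextAction M c) c)        ≡⟨ copy-perform (nextAction M c) c ⟩
    perform M′ O (nextAction M c) (copy c)       ≡⟨ cong (λ a → perform M′ O a (copy c)) (nextAction-copy c) ⟩
    perform M′ O (nextAction M′ (copy c)) (copy c) ≡⟨ cong (step M′ O) (copy-configAt t) ⟩
    step M′ O (configAt M′ O x t)                ∎
    where open ≡-Reasoning
          c = configAt M O x t

  outcome-copy : ∀ t → outcome M O x t ≡ outcome M′ O x t
  outcome-copy t = cong accepts
    (trans (nextAction-copy _) (cong (nextAction M′) (copy-configAt t)))

outcome-≈ : ∀ {m} {M M′ : OracleTM m} → M ≈ M′ → ∀ O x t → outcome M O x t ≡ outcome M′ O x t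
outcome-≈ (same e) = outcome-copy e

-- Enumeration of machines

-- Cantor's walk along the antidiagonals.
next : ℕ × ℕ → ℕ × ℕ
next (a , zero)  = 0 , suc a
next (a , suc b) = suc a , b

unpair : ℕ → ℕ × ℕ
unpair zero    = 0 , 0
unpair (suc n) = next (unpair n)

unpair-surjective : ∀ a b → ∃[ n ] unpair n ≡ (a , b)
unpair-surjective a b = onDiagonal (a + b) a b refl
  where
  onDiagonal : ∀ s a b → a + b ≡ s → ∃[ n ] unpair n ≡ (a , b)
  onDiagonal zero    zero    zero    refl = 0 , refl
  onDiagonal (suc s) zero    (suc b) refl =
    let n , e = onDiagonal b b 0 (+-identityʳ b) in suc n , cong next e
  onDiagonal s       (suc a) b       eq   =
    let n , e = onDiagonal s a (suc b) (trans (+-suc a b) eq) in suc n , cong next e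

-- Makes indices large on demand: the code of `(a , n₀)` is at least `n₀`.
sum-unpair : ∀ n → proj₁ (unpair n) + proj₂ (unpair n) ≤ n
sum-unpair zero    = z≤n
sum-unpair (suc n) = ≤-trans (sum-next (unpair n)) (s≤s (sum-unpair n))
  where
  sum-next : ∀ p → proj₁ (next p) + proj₂ (next p) ≤ suc (proj₁ p + proj₂ p)
  sum-next (a , zero)  = s≤s (m≤m+n a 0)
  sum-next (a , suc b) = s≤s (+-monoʳ-≤ a (n≤1+n b))

record Enumeration (X : Set) (_∼_ : X → X → Set) : Set where
  field
    enum  : ℕ → X
    cover : ∀ x → ∃[ n ] (enum n ∼ x)

open Enumeration

Countable : Set → Set
Countable X = Enumeration X _≡_

viaPairs : ∀ {X : Set} {_∼_ : X → X → Set} (f : ℕ → ℕ → X) →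
           (∀ x → ∃[ a ] ∃[ b ] (f a b ∼ x)) → Enumeration X _∼_
viaPairs {_∼_ = _∼_} f c .enum n = f (proj₁ (unpair n)) (proj₂ (unpair n))
viaPairs {_∼_ = _∼_} f c .cover x =
  let a , b , e = c x
      n , eq    = unpair-surjective a b
  in n , subst (λ p → f (proj₁ p) (proj₂ p) ∼ x) (sym eq) e

countable-Bool : Countable Bool
countable-Bool .enum zero    = false
countable-Bool .enum (suc _) = true
countable-Bool .cover false = 0 , refl
countable-Bool .cover true  = 1 , refl

countable-Fin : ∀ n → Countable (Fin (suc n))
countable-Fin n .enum zero = zero
countable-Fin zero    .enum (suc _) = zero
countable-Fin (suc n) .enum (suc k) = suc (countable-Fin n .enum k)
countable-Fin n .cover zero = 0 , refl
countable-Fin (suc n) .cover (suc i) =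
  let k , e = countable-Fin n .cover i in suc k , cong suc e

countable-× : ∀ {X Y} → Countable X → Countable Y → Countable (X × Y)
countable-× E F = viaPairs (λ a b → enum E a , enum F b) λ (x , y) →
  let a , e = cover E x
      b , f = cover F y
  in a , b , cong₂ _,_ e f

countable-Vec : ∀ {X} → Countable X → ∀ n → Countable (Vec X n)
countable-Vec E zero .enum _ = []
countable-Vec E zero .cover [] = 0 , refl
countable-Vec E (suc n) = viaPairs (λ a b → enum E a ∷ enum (countable-Vec E n) b) λ where
  (x ∷ xs) → let a , e = cover E x
                 b , f = cover (countable-Vec E n) xs
             in a , b , cong₂ _∷_ e f

countable-Move : Countable Move
countable-Move .enum 0 = left
countable-Move .enum 1 = stay
countable-Move .enum (suc (suc _)) = right
countable-Move .cover left  = 0 , refl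
countable-Move .cover stay  = 1 , refl
countable-Move .cover right = 2 , refl

fromCode : ∀ {g} → Fin (3 + g) → Symbol g
fromCode zero                = blank
fromCode (suc zero)          = bit false
fromCode (suc (suc zero))    = bit true
fromCode (suc (suc (suc i))) = mark i

toCode : ∀ {g} → Symbol g → Fin (3 + g)
toCode blank       = zero
toCode (bit false) = suc zero
toCode (bit true)  = suc (suc zero)
toCode (mark i)    = suc (suc (suc i))

fromCode-toCode : ∀ {g} (s : Symbol g) → fromCode (toCode s) ≡ s
fromCode-toCode blank       = refl
fromCode-toCode (bit false) = refl
fromCode-toCode (bit true)  = refl
fromCode-toCode (mark i)    = refl

countable-Symbol : ∀ g → Countable (Symbol g)
countable-Symbol g .enum n = fromCode (countable-Fin (2 + g) .enum n)
countable-Symbol g .cover s =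
  let n , e = countable-Fin (2 + g) .cover (toCode s)
  in n , trans (cong fromCode e) (fromCode-toCode s)

countable-Action : ∀ m s T g → Countable (Action (suc m) (suc s) T g)
countable-Action m s T g = viaPairs code λ where
    (continue q ws)  → let a , e = cover moves (q , ws) in 0 , a , cong (uncurry continue) e
    (query i y n)    → let a , e = cover asks (i , y , n)
                       in 1 , a , cong (λ (i , y , n) → query i y n) e
    (halt b)         → let a , e = cover countable-Bool b in 2 , a , cong halt e
  where
  moves = countable-× (countable-Fin s)
            (countable-Vec (countable-× (countable-Symbol g) countable-Move) T)
  asks  = countable-× (countable-Fin m) (countable-× (countable-Fin s) (countable-Fin s))

  code : ℕ → ℕ → Action (suc m) (suc s) T g
  code 0 a = uncurry continue (enum moves a)
  code 1 a = let i , y , n = enum asks a in query i y n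
  code (suc (suc _)) a = halt (enum countable-Bool a)

Pointwise : ∀ {X Y : Set} → (Y → Y → Set) → (X → Y) → (X → Y) → Set
Pointwise _∼_ f g = ∀ x → f x ∼ g x

module _ {Y : Set} {_∼_ : Y → Y → Set} (E : Enumeration Y _∼_) where

  enumerate-Fin→ : ∀ n → Enumeration (Fin n → Y) (Pointwise _∼_)
  enumerate-Fin→ zero .enum _ ()
  enumerate-Fin→ zero .cover f = 0 , λ ()
  enumerate-Fin→ (suc n) = viaPairs code λ f →
    let a , e = cover E (f zero)
        b , h = cover (enumerate-Fin→ n) (f ∘ suc)
    in a , b , λ { zero → e ; (suc i) → h i }
    where
    code : ℕ → ℕ → Fin (suc n) → Y
    code a b zero    = enum E a
    code a b (suc i) = enum (enumerate-Fin→ n) b i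

  enumerate-Symbol→ : ∀ g → Enumeration (Symbol g → Y) (Pointwise _∼_)
  enumerate-Symbol→ g .enum n = enum (enumerate-Fin→ (3 + g)) n ∘ toCode
  enumerate-Symbol→ g .cover f =
    let n , h = cover (enumerate-Fin→ (3 + g)) (f ∘ fromCode)
    in n , λ s → subst (λ s′ → enum (enumerate-Fin→ (3 + g)) n (toCode s) ∼ f s′)
                       (fromCode-toCode s) (h (toCode s))

-- By currying, a transition table on several tapes is a finite table of tables on one tape fewer.
enumerate-Vec→ : ∀ {Y g} {_∼_ : Y → Y → Set} → Enumeration Y _∼_ → ∀ n →
                 Enumeration (Vec (Symbol g) n → Y) (Pointwise _∼_)
enumerate-Vec→ E zero .enum k [] = enum E k
enumerate-Vec→ E zero .cover f =
  let k , e = cover E (f []) in k , λ { [] → e }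
enumerate-Vec→ {g = g} E (suc n) .enum k (s ∷ ss) =
  enum (enumerate-Symbol→ (enumerate-Vec→ E n) g) k s ss
enumerate-Vec→ {g = g} E (suc n) .cover f =
  let k , h = cover (enumerate-Symbol→ (enumerate-Vec→ E n) g) (λ s ss → f (s ∷ ss))
  in k , λ { (s ∷ ss) → h s ss }

countable-ℕ : Countable ℕ
countable-ℕ .enum n  = n
countable-ℕ .cover n = n , refl

enumerate-× : ∀ {X Y : Set} {_∼_ : Y → Y → Set} → Countable X → Enumeration Y _∼_ →
              Enumeration (X × Y) (λ (x , y) (x′ , y′) → x ≡ x′ × y ∼ y′)
enumerate-× E F = viaPairs (λ a b → enum E a , enum F b) λ (x , y) →
  let a , e = cover E x
      b , f = cover F y
  in a , b , e , f

-- The type of a transition function depends on the numbers of states, tapes and marks. Since `F i`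
-- reaches `y` only up to `_∼_`, the covering hypothesis must tolerate every related `y′`.
enumerate-family : ∀ {I Z : Set} {Y : I → Set} {_∼_ : ∀ {i} → Y i → Y i → Set} {_≋_ : Z → Z → Set} →
                   Countable I → (∀ i → Enumeration (Y i) _∼_) → (f : ∀ i → Y i → Z) →
                   (∀ z → ∃[ i ] ∃[ y ] (∀ y′ → y′ ∼ y → f i y′ ≋ z)) → Enumeration Z _≋_
enumerate-family {_≋_ = _≋_} E F f c =
  viaPairs (λ a b → f (enum E a) (enum (F (enum E a)) b)) λ z →
  let i , y , h = c z
      a , e     = cover E i
      b , r     = cover (F i) y
  in a , b , subst (λ i′ → f i′ (enum (F i′) b) ≋ z) (sym e) (h _ r)

-- `suc s` loses no machine, because a start state exists; it makes the type of states inhabited, as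
-- its enumeration requires.
Program : ℕ → ℕ × ℕ × ℕ → Set
Program m (s , w , g) =
  Fin (suc s) × (Fin (suc s) → Vec (Symbol g) (suc (suc m + w)) →
                 Action (suc m) (suc s) (suc (suc m + w)) g)

_∼ₚ_ : ∀ {m i} → Program m i → Program m i → Set
(q , d) ∼ₚ (q′ , d′) = q ≡ q′ × Pointwise (Pointwise _≡_) d d′

enumerate-programs : ∀ m i → Enumeration (Program m i) (_∼ₚ_ {m} {i})
enumerate-programs m (s , w , g) =
  enumerate-× (countable-Fin s)
    (enumerate-Fin→ (enumerate-Vec→ (countable-Action m s (suc (suc m + w)) g) (suc (suc m + w))) (suc s))

assemble : ∀ {m} i → Program m i → OracleTM (suc m)
assemble (s , w , g) (q₀ , d) = machine (suc s) w g q₀ d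

enumerate-machines : ∀ m → Enumeration (OracleTM (suc m)) _≈_
enumerate-machines m =
  enumerate-family {_∼_ = λ {i} → _∼ₚ_ {m} {i}}
    (countable-× countable-ℕ (countable-× countable-ℕ countable-ℕ))
    (enumerate-programs m) assemble λ { (machine (suc s) w g q₀ d) →
      (s , w , g) , (q₀ , d) , λ { _ (refl , e) → same e } }

-- The first component of unpair takes every value at arbitrarily large arguments.
recurrent : ∀ {X : Set} {_∼_ : X → X → Set} → Enumeration X _∼_ → ℕ → X
recurrent E n = enum E (proj₁ (unpair n))

recurrent-covers : ∀ {X : Set} {_∼_ : X → X → Set} (E : Enumeration X _∼_) x n₀ →
                   ∃[ n ] (n₀ ≤ n × recurrent E n ∼ x)
recurrent-covers {_∼_ = _∼_} E x n₀ =
  let a , e  = cover E x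
      n , eq = unpair-surjective a n₀
  in n ,
     ≤-trans (subst (λ p → n₀ ≤ proj₁ p + proj₂ p) (sym eq) (m≤n+m n₀ a)) (sum-unpair n) ,
     subst (λ p → enum E (proj₁ p) ∼ x) (sym eq) e

-- Unfolding the enumeration during conversion checking is prohibitively slow.
abstract
  machineAt : ∀ m → ℕ → OracleTM (suc m)
  machineAt m = recurrent (enumerate-machines m)

  machineAt-covers : ∀ {m} (M : OracleTM (suc m)) n₀ →
                     ∃[ n ] (n₀ ≤ n × machineAt m n ≈ M)
  machineAt-covers = recurrent-covers (enumerate-machines _)

-- Worlds

ones : ℕ → Word
ones n = List.replicate n true

unary : ℕ → Word → Word
unary n w = ones n ++ false ∷ w

splitUnary : Word → ℕ × Maybe Word
splitUnary []          = 0 , nothing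
splitUnary (false ∷ w) = 0 , just w
splitUnary (true ∷ w)  = let n , r = splitUnary w in suc n , r

splitUnary-ones : ∀ n → splitUnary (ones n) ≡ (n , nothing)
splitUnary-ones zero                              = refl
splitUnary-ones (suc n) rewrite splitUnary-ones n = refl

splitUnary-unary : ∀ n w → splitUnary (unary n w) ≡ (n , just w)
splitUnary-unary zero    w                              = refl
splitUnary-unary (suc n) w rewrite splitUnary-unary n w = refl

splitUnary⁻¹-ones : ∀ w {n} → splitUnary w ≡ (n , nothing) → w ≡ ones n
splitUnary⁻¹-ones []         refl = refl
splitUnary⁻¹-ones (true ∷ w) eq with splitUnary w in e
splitUnary⁻¹-ones (true ∷ w) refl | n , nothing = cong (true ∷_) (splitUnary⁻¹-ones w e)

splitUnary⁻¹-unary : ∀ w {n v} → splitUnary w ≡ (n , just v) → w ≡ unary n v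
splitUnary⁻¹-unary (false ∷ w) refl = refl
splitUnary⁻¹-unary (true ∷ w) eq with splitUnary w in e
splitUnary⁻¹-unary (true ∷ w) refl | n , just v = cong (true ∷_) (splitUnary⁻¹-unary w e)

length-unary : ∀ n w → length (unary n w) ≡ suc (n + length w)
length-unary n w = trans (length-++ (ones n)) (trans
  (cong (_+ suc (length w)) (length-replicate n)) (+-suc n (length w)))

-- The words that A interprets: true^m asks for the bit m of the world, and
-- c true^N false true^e false x asks for the outcome of machine e on x after 2^N
-- steps in the world whose bit at cur N is replaced by c.
data Request : Set where
  bitOf    : ℕ → Request
  simulate : Bool → ℕ → ℕ → Word → Request
  junk     : Request

parseInput : Bool → ℕ → ℕ × Maybe Word → Request
parseInput c N (e , just x)  = simulate c N e x
parseInput c N (_ , nothing) = junk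

parseBound : Bool → ℕ × Maybe Word → Request
parseBound c (N , just w)  = parseInput c N (splitUnary w)
parseBound c (_ , nothing) = junk

-- A well-formed simulation request contains a separating `false` whatever its first letter is, so
-- the two formats cannot collide.
parseHead : Word → ℕ × Maybe Word → Request
parseHead _       (m , nothing) = bitOf m
parseHead []      (_ , just _)  = junk
parseHead (c ∷ w) (_ , just _)  = parseBound c (splitUnary w)

parse : Word → Request
parse w = parseHead w (splitUnary w)

request : Bool → ℕ → ℕ → Word → Word
request c N e x = c ∷ unary N (unary e x)

parse-ones : ∀ m → parse (ones m) ≡ bitOf m
parse-ones m rewrite splitUnary-ones m = refl

parse-request : ∀ c N e x → parse (request c N e x) ≡ simulate c N e x
parse-request false N e x
  rewrite splitUnary-unary N (unary e x) | splitUnary-unary e x = refl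
parse-request true  N e x
  rewrite splitUnary-unary N (unary e x) | splitUnary-unary N (unary e x) | splitUnary-unary e x = refl

parse⁻¹-bitOf : ∀ w {m} → parse w ≡ bitOf m → w ≡ ones m
parse⁻¹-bitOf w eq with splitUnary w in e
parse⁻¹-bitOf w       refl | _ , nothing = splitUnary⁻¹-ones w e
parse⁻¹-bitOf (c ∷ w) eq   | _ , just _ with splitUnary w
... | _ , just v with splitUnary v
parse⁻¹-bitOf (c ∷ w) () | _ , just _ | _ , just v | _ , just _
parse⁻¹-bitOf (c ∷ w) () | _ , just _ | _ , just v | _ , nothing

-- The time exponent is written in unary. Hence a simulation queries only words of length at most
-- `2 ^ N < 2 ^ length w`, shorter than any padded form of `w`.
parse-simulate-< : ∀ w {c N e x} → parse w ≡ simulate c N e x → N < length w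
parse-simulate-< w eq with splitUnary w
parse-simulate-< (c ∷ w) eq   | _ , just _ with splitUnary w in ew
... | _ , just v with splitUnary v
parse-simulate-< (c ∷ w) refl | _ , just _ | N , just v | _ , just _
  rewrite splitUnary⁻¹-unary w ew | length-unary N v = s≤s (m≤n⇒m≤1+n (m≤m+n N _))

World : Set
World = ℕ → Bool

_[_≔_] : World → ℕ → Bool → World
(β [ m ≔ b ]) n = if does (n ≟ m) then b else β n

update-same : ∀ β m b → (β [ m ≔ b ]) m ≡ b
update-same β m b rewrite dec-true (m ≟ m) refl = refl

update-other : ∀ β {m n} b → n ≢ m → (β [ m ≔ b ]) n ≡ β n
update-other β {m} {n} b n≢m rewrite dec-false (n ≟ m) n≢m = refl

Agree : ℕ → World → World → Set
Agree L β β′ = ∀ m → m ≤ L → β m ≡ β′ m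

-- Worlds that differ only at `m` become indistinguishable after the overwrite; this is how
-- prescribing `c` hides the bit at `cur N`.
update-agree : ∀ {L β β′} m b → (∀ n → n ≤ L → n ≢ m → β n ≡ β′ n) →
               Agree L (β [ m ≔ b ]) (β′ [ m ≔ b ])
update-agree {_} {β} {β′} m b agree n n≤L with n ≟ m
... | yes refl = trans (update-same β m b) (sym (update-same β′ m b))
... | no n≢m   = trans (update-other β b n≢m)
                       (trans (agree n n≤L n≢m) (sym (update-other β′ b n≢m)))

-- (p , r , m) after u units: m is the last threshold, p + 1 units are left until
-- u + 1 is a power of two, and r + 1 such events are left until the next threshold.
Scan : Set
Scan = ℕ × ℕ × ℕ

advance : ℕ → Scan → Scan
advance u (suc p , r     , m) = p , r , m
advance u (zero  , suc r , m) = suc u , r , m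
advance u (zero  , zero  , m) = suc u , suc u , suc u

scan : ℕ → Scan
scan zero    = 0 , 0 , 0
scan (suc u) = advance u (scan u)

cur : ℕ → ℕ
cur u = proj₂ (proj₂ (scan u))

cur≤ : ∀ u → cur u ≤ u
cur≤ zero = z≤n
cur≤ (suc u) with scan u | cur≤ u
... | suc _ , _     , _ | m≤u = m≤n⇒m≤1+n m≤u
... | zero  , suc _ , _ | m≤u = m≤n⇒m≤1+n m≤u
... | zero  , zero  , _ | _   = ≤-refl

-- The oracle is a parameter, and a function of the world, because `B` is defined from `A` and a
-- simulation consults the oracle of an altered world.
interpret : (World → Language) → World → Request → Bool
interpret 𝓑 β (bitOf m)          = β m
interpret 𝓑 β (simulate c N e x) =
  outcome (machineAt 0 e) (𝓑 (β [ cur N ≔ c ]) ∷ []) x (2 ^ N)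
interpret 𝓑 β junk               = false

answer : (World → Language) → World → Language
answer 𝓑 β z = interpret 𝓑 β (parse z)

-- Insufficient padding codes nothing; otherwise a short word of `B` would reveal a long word of
-- `A`.
unpadSplit : ℕ × Maybe Word → Maybe Word
unpadSplit (P , just z)  = if does (2 ^ length z ≤? P) then just z else nothing
unpadSplit (_ , nothing) = nothing

unpad : Word → Maybe Word
unpad v = unpadSplit (splitUnary v)

unpad-unary : ∀ P z → 2 ^ length z ≤ P → unpad (unary P z) ≡ just z
unpad-unary P z h rewrite splitUnary-unary P z | dec-true (2 ^ length z ≤? P) h = refl

unpad-< : ∀ v {z} → unpad v ≡ just z → 2 ^ length z < length v
unpad-< v eq with splitUnary v in e
... | P , just z with 2 ^ length z ≤? P
unpad-< v eq | P , just z | no h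
  rewrite dec-false (2 ^ length z ≤? P) h with () ← eq
unpad-< v eq | P , just z | yes h
  rewrite dec-true (2 ^ length z ≤? P) h with refl ← eq
  rewrite splitUnary⁻¹-unary v e | length-unary P z = s≤s (≤-trans h (m≤m+n P _))

-- The oracle of a world, restricted to words of length at most s.
level : ℕ → World → Language
level zero    β v = false
level (suc s) β v with unpad v
... | just z  = answer (level s) β z
... | nothing = false

simulate-cong : ∀ 𝓑 𝓑′ β β′ c N e x →
  (∀ w → length w ≤ 2 ^ N → 𝓑 (β [ cur N ≔ c ]) w ≡ 𝓑′ (β′ [ cur N ≔ c ]) w) →
  interpret 𝓑 β (simulate c N e x) ≡ interpret 𝓑′ β′ (simulate c N e x)
simulate-cong 𝓑 𝓑′ β β′ c N e x agree = outcome-cong (machineAt 0 e) _ _ x (2 ^ N) λ where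
  zero w _ short → agree w short

-- `agree𝓑` ranges over all pairs of agreeing worlds because a simulation leaves the pair at hand by
-- its update.
answer-cong : ∀ {𝓑 𝓑′ β β′} L z → length z ≤ L → Agree L β β′ →
  (∀ ω ω′ w → Agree L ω ω′ → length w < 2 ^ length z → 𝓑 ω w ≡ 𝓑′ ω′ w) →
  answer 𝓑 β z ≡ answer 𝓑′ β′ z
answer-cong {𝓑} {𝓑′} {β} {β′} L z z≤L agree agree𝓑 with parse z in eq
... | bitOf m = agree m (≤-trans (≤-reflexive m≡) z≤L)
  where m≡ = trans (sym (length-replicate m)) (cong length (sym (parse⁻¹-bitOf z eq)))
... | simulate c N e x = simulate-cong 𝓑 𝓑′ β β′ c N e x λ w w≤ →
  agree𝓑 _ _ w (update-agree (cur N) c λ n n≤L _ → agree n n≤L)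
    (≤-<-trans w≤ (^-monoʳ-< 2 (s≤s (s≤s z≤n)) (parse-simulate-< z eq)))
... | junk = refl

-- If `v` codes `z`, then `2 ^ length z < length v ≤ 2 ^ L`, so `z` can ask only for bits up to `L`,
-- and the words queried by its simulations are shorter than `v`. This gives independence of the
-- depth and locality in the world at once.
level-stable : ∀ s s′ {β β′} L v → length v ≤ s → length v ≤ s′ → length v ≤ 2 ^ L →
               Agree L β β′ → level s β v ≡ level s′ β′ v
level-stable zero    zero     L []      _ _ _ _ = refl
level-stable zero    (suc s′) L []      _ _ _ _ = refl
level-stable (suc s) zero     L []      _ _ _ _ = refl
level-stable zero    _        L (_ ∷ _) () _ _ _
level-stable (suc s) zero     L (_ ∷ _) _ () _ _
level-stable (suc s) (suc s′) L v v≤s v≤s′ v≤2^L agree with unpad v in eq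
... | nothing = refl
... | just z  = answer-cong L z z≤L agree λ ω ω′ w agreeω w< →
    let w<v = <-trans w< (unpad-< v eq) in
    level-stable s s′ L w (s≤s⁻¹ (≤-trans w<v v≤s)) (s≤s⁻¹ (≤-trans w<v v≤s′))
      (≤-trans (<⇒≤ w<v) v≤2^L) agreeω
  where
  z≤L : length z ≤ L
  z≤L = ≮⇒≥ λ L<z → <⇒≱ (<-≤-trans (unpad-< v eq) v≤2^L) (^-monoʳ-≤ 2 (<⇒≤ L<z))

oracle : World → Language
oracle β v = level (length v) β v

oracle-local : ∀ {β β′} L v → length v ≤ 2 ^ L → Agree L β β′ → oracle β v ≡ oracle β′ v
oracle-local L v = level-stable (length v) (length v) L v ≤-refl ≤-refl

language : World → Language
language = answer oracle

-- The fixed-point equation tying `B` to `A`: depth `P + length z` remains after one unfolding,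
-- enough for every word shorter than `2 ^ length z`.
oracle-unary : ∀ β P z → 2 ^ length z ≤ P → oracle β (unary P z) ≡ language β z
oracle-unary β P z h rewrite length-unary P z | unpad-unary P z h =
  answer-cong (length z) z ≤-refl (λ _ _ → refl) λ ω ω′ w agree w< →
    level-stable (P + length z) (length w) (length z) w
      (≤-trans (<⇒≤ w<) (≤-trans h (m≤m+n P _))) ≤-refl (<⇒≤ w<) agree

-- Thresholds and diagonalisation

countdown : ∀ i {u p r m} → scan u ≡ (i + p , r , m) → scan (i + u) ≡ (p , r , m)
countdown zero                eq = eq
countdown (suc i) {u} {p} {r} {m} eq =
  cong (advance (i + u)) (countdown i (trans eq (cong (λ q → q , r , m) (sym (+-suc i p)))))

-- The time of the next threshold when the scan at time `u` is `(u , r , m)`: an event comes each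
-- time `suc u` has doubled.
grow : ℕ → ℕ → ℕ
grow zero    u = suc (u + u)
grow (suc r) u = grow r (suc (u + u))

suc-grow : ∀ r u → suc (grow r u) ≡ 2 ^ suc r * suc u
suc-grow zero    u = sym (trans (cong (suc u +_) (+-identityʳ (suc u))) (cong suc (+-suc u u)))
suc-grow (suc r) u = begin
  suc (grow r (suc (u + u)))  ≡⟨ suc-grow r (suc (u + u)) ⟩
  2 ^ suc r * suc (suc (u + u)) ≡⟨ cong (2 ^ suc r *_) (suc-grow zero u) ⟩
  2 ^ suc r * (2 * suc u)     ≡⟨ *-assoc (2 ^ suc r) 2 (suc u) ⟨
  2 ^ suc r * 2 * suc u       ≡⟨ cong (_* suc u) (*-comm (2 ^ suc r) 2) ⟩
  2 ^ suc (suc r) * suc u     ∎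
  where open ≡-Reasoning

scan-grow : ∀ r {u m} → scan u ≡ (u , r , m) →
  (∀ v → u ≤ v → v < grow r u → cur v ≡ m) ×
  scan (grow r u) ≡ (grow r u , grow r u , grow r u)
scan-grow r {u} {m} eq = between r eq , end r eq
  where
  during : ∀ r {u} → scan u ≡ (u , r , m) → ∀ v → u ≤ v → v ≤ u + u → cur v ≡ m
  during r {u} eq v u≤v v≤2u = begin
    cur v             ≡⟨ cong cur (m∸n+n≡m u≤v) ⟨
    cur (v ∸ u + u)   ≡⟨ cong (proj₂ ∘ proj₂) (countdown (v ∸ u) {p = u ∸ (v ∸ u)}
                           (trans eq (cong (λ p → p , r , m) (sym (m+[n∸m]≡n v∸u≤u))))) ⟩
    m                 ∎
    where
    open ≡-Reasoning
    v∸u≤u = ≤-trans (∸-monoˡ-≤ u v≤2u) (≤-reflexive (m+n∸n≡m u u))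

  double : ∀ r {u} → scan u ≡ (u , r , m) → scan (suc (u + u)) ≡ advance (u + u) (0 , r , m)
  double r {u} eq = cong (advance (u + u))
    (countdown u (trans eq (cong (λ p → p , r , m) (sym (+-identityʳ u)))))

  between : ∀ r {u} → scan u ≡ (u , r , m) → ∀ v → u ≤ v → v < grow r u → cur v ≡ m
  between zero    eq v u≤v v<g = during zero eq v u≤v (s≤s⁻¹ v<g)
  between (suc r) {u} eq v u≤v v<g with ≤-<-connex v (u + u)
  ... | inj₁ v≤2u = during (suc r) eq v u≤v v≤2u
  ... | inj₂ v>2u = between r (double (suc r) eq) v v>2u v<g

  end : ∀ r {u} → scan u ≡ (u , r , m) → scan (grow r u) ≡ (grow r u , grow r u , grow r u)
  end zero    eq = double zero eq
  end (suc r) eq = end r (double (suc r) eq)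

-- The sequence 0, 1, 7, 2047, ...; by `suc-grow`, each term is exponential in the one before.
θ : ℕ → ℕ
θ zero    = 0
θ (suc j) = grow (θ j) (θ j)

scan-θ : ∀ j → scan (θ j) ≡ (θ j , θ j , θ j)
scan-θ zero    = refl
scan-θ (suc j) = proj₂ (scan-grow (θ j) (scan-θ j))

cur-θ : ∀ j v → θ j ≤ v → v < θ (suc j) → cur v ≡ θ j
cur-θ j = proj₁ (scan-grow (θ j) (scan-θ j))

-- Thresholds against polynomials

2^suc-θ≤ : ∀ j → 2 ^ suc (θ j) ≤ suc (θ (suc j))
2^suc-θ≤ j = ≤-trans (m≤m*n (2 ^ suc (θ j)) (suc (θ j)))
                     (≤-reflexive (sym (suc-grow (θ j) (θ j))))

n<2^n : ∀ n → n < 2 ^ n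
n<2^n zero    = s≤s z≤n
n<2^n (suc n) = +-mono-≤ (≤-trans (s≤s z≤n) (n<2^n n)) (≤-trans (n<2^n n) (m≤m+n _ 0))

θ<θ-suc : ∀ j → θ j < θ (suc j)
θ<θ-suc j = s≤s⁻¹ (≤-trans (n<2^n (suc (θ j))) (2^suc-θ≤ j))

θ-mono : ∀ {i j} → i ≤ j → θ i ≤ θ j
θ-mono {i} i≤j = go (≤⇒≤′ i≤j)
  where
  go : ∀ {j} → i ≤′ j → θ i ≤ θ j
  go ≤′-refl         = ≤-refl
  go (≤′-step {j} p) = ≤-trans (go p) (<⇒≤ (θ<θ-suc j))

n≤θn : ∀ n → n ≤ θ n
n≤θn zero    = z≤n
n≤θn (suc n) = ≤-<-trans (n≤θn n) (θ<θ-suc n)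

-- Turns a power of `θ j` into a power of two, so that polynomial bounds are compared through
-- exponents.
suc-θ-power : ∀ j → ∃[ q ] (j ≤ q × suc (θ j) ≡ 2 ^ q)
suc-θ-power zero    = 0 , z≤n , refl
suc-θ-power (suc j) with suc-θ-power j
... | q , j≤q , eq = suc (θ j) + q ,
  s≤s (≤-trans j≤q (m≤n+m q (θ j))) ,
  trans (suc-grow (θ j) (θ j))
        (trans (cong (2 ^ suc (θ j) *_) eq) (sym (^-distribˡ-+-* 2 (suc (θ j)) q)))

-- The offset is 4 because `3 * 3` exceeds `2 ^ 3`.
n²≤2^n : ∀ d → (4 + d) * (4 + d) ≤ 2 ^ (4 + d)
n²≤2^n zero    = ≤-refl
n²≤2^n (suc d) = begin
  suc n * suc n       ≡⟨ cong (suc n +_) (*-suc n n) ⟩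
  suc n + (n + n * n) ≡⟨ +-assoc (suc n) n (n * n) ⟨
  suc n + n + n * n   ≤⟨ +-monoˡ-≤ (n * n) 2n+1≤n² ⟩
  n * n + n * n       ≤⟨ +-mono-≤ (n²≤2^n d) (≤-trans (n²≤2^n d) (m≤m+n _ 0)) ⟩
  2 ^ suc n           ∎
  where
  open ≤-Reasoning
  n = 4 + d
  2n+1≤n² : suc n + n ≤ n * n
  2n+1≤n² = begin
    suc n + n       ≤⟨ +-monoˡ-≤ n (+-monoˡ-≤ n (s≤s (z≤n {3 + d}))) ⟩
    n + n + n       ≡⟨ trans (+-assoc n n n) (cong (λ k → n + (n + k)) (sym (+-identityʳ n))) ⟩
    3 * n           ≤⟨ *-monoˡ-≤ n (s≤s (s≤s (s≤s (z≤n {suc d})))) ⟩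
    n * n           ∎

-- With `suc (θ j) = 2 ^ q` it suffices that `3 + (q * k + k) ≤ q * q ≤ 2 ^ q`; the first inequality
-- follows from `4 + k ≤ q`, the second from `4 ≤ q`.
polyBound-θ : ∀ k j → 4 + k ≤ j → polyBound k (θ j) ≤ 2 ^ (θ j ∸ 1)
polyBound-θ k j k+4≤j with suc-θ-power j
... | q , j≤q , eq = begin
  θ j ^ k + k               ≤⟨ +-mono-≤ θ^k≤ (≤-trans (<⇒≤ (n<2^n k)) (≤-trans
                                 (^-monoʳ-≤ 2 (m≤n+m k (q * k))) (m≤m+n _ 0))) ⟩
  2 ^ suc (q * k + k)       ≤⟨ ^-monoʳ-≤ 2 (∸-monoˡ-≤ 2 exponent) ⟩
  2 ^ (θ j ∸ 1)             ∎
  where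
  open ≤-Reasoning
  4+k≤q = ≤-trans k+4≤j j≤q
  θ^k≤ : θ j ^ k ≤ 2 ^ (q * k + k)
  θ^k≤ = begin
    θ j ^ k         ≤⟨ ^-monoˡ-≤ k (n≤1+n (θ j)) ⟩
    suc (θ j) ^ k   ≡⟨ cong (_^ k) eq ⟩
    (2 ^ q) ^ k     ≡⟨ ^-*-assoc 2 q k ⟩
    2 ^ (q * k)     ≤⟨ ^-monoʳ-≤ 2 (m≤m+n (q * k) k) ⟩
    2 ^ (q * k + k) ∎
  exponent : 3 + (q * k + k) ≤ suc (θ j)
  exponent = begin
    3 + (q * k + k) ≡⟨ trans (+-comm 3 _) (+-assoc (q * k) k 3) ⟩
    q * k + (k + 3) ≤⟨ +-monoʳ-≤ (q * k) (≤-trans (≤-reflexive (+-comm k 3)) (≤-trans (n≤1+n _) 4+k≤q)) ⟩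
    q * k + q       ≡⟨ trans (+-comm (q * k) q) (sym (*-suc q k)) ⟩
    q * suc k       ≤⟨ *-monoʳ-≤ q (≤-trans (m≤n+m (suc k) 3) 4+k≤q) ⟩
    q * q           ≡⟨ cong (λ n → n * n) q≡ ⟨
    (4 + (q ∸ 4)) * (4 + (q ∸ 4)) ≤⟨ n²≤2^n (q ∸ 4) ⟩
    2 ^ (4 + (q ∸ 4)) ≡⟨ cong (2 ^_) q≡ ⟩
    2 ^ q           ≡⟨ eq ⟨
    suc (θ j)       ∎
    where q≡ = m+[n∸m]≡n (≤-trans (m≤m+n 4 k) 4+k≤q)

2^[θ∸1]<θ : ∀ j → 1 ≤ j → 2 ^ (θ j ∸ 1) < θ (suc j)
2^[θ∸1]<θ j 1≤j with θ j | n≤θn j | 2^suc-θ≤ j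
... | zero  | j≤0 | _ = contradiction (≤-trans 1≤j j≤0) λ ()
... | suc m | _   | h = s≤s⁻¹ (<-≤-trans (s≤s (^-monoʳ-< 2 (s≤s (s≤s z≤n)) (n<1+n m)))
  (≤-trans (^-monoʳ-< 2 (s≤s (s≤s z≤n)) (n<1+n (suc m))) h))

-- The diagonal world

diagonalBit : World → ℕ → Bool
-- The time eventually exceeds every polynomial in `θ j`, but is too short, from `j = 1` on, to
-- write a word of `B` that depends on the bit `θ j` or a word of `A` of length `θ (suc j)`.
diagonalBit β j = not (outcome (machineAt 1 j) (oracle β ∷ language β ∷ [])
                               (ones (θ j)) (2 ^ (θ j ∸ 1)))

stage : ℕ → World
stage zero    = λ _ → false
stage (suc j) = stage j [ θ j ≔ diagonalBit (stage j) j ]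

-- Bit `m` is final from stage `suc m` on: later changes occur at `θ i` with `m < i ≤ θ i`.
limit : World
limit m = stage (suc m) m

stage-stable : ∀ {i j m} → i ≤ j → m < θ i → stage j m ≡ stage i m
stage-stable {i} {m = m} i≤j m<θ = go (≤⇒≤′ i≤j)
  where
  go : ∀ {j} → i ≤′ j → stage j m ≡ stage i m
  go ≤′-refl         = refl
  go (≤′-step {j} p) =
    trans (update-other (stage j) _ (<⇒≢ (<-≤-trans m<θ (θ-mono (≤′⇒≤ p))))) (go p)

limit-stage : ∀ {j m} → m < θ j → limit m ≡ stage j m
limit-stage {j} {m} m<θ with ≤-total j (suc m)
... | inj₁ j≤m = stage-stable j≤m m<θ
... | inj₂ m<j = sym (stage-stable m<j (n≤θn (suc m)))

limit-θ : ∀ j → limit (θ j) ≡ diagonalBit (stage j) j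
limit-θ j = trans (limit-stage {suc j} (θ<θ-suc j)) (update-same (stage j) (θ j) _)

limit-off-θ : ∀ {j m} → m < θ (suc j) → m ≢ θ j → limit m ≡ stage j m
limit-off-θ {j} m<θ m≢ = trans (limit-stage {suc j} m<θ) (update-other (stage j) _ m≢)

-- Both values of the bit at θ j are simulated by A, so no other word of
-- length below θ (suc j) depends on that bit.
language-off-θ : ∀ j {β β′} z → (∀ m → m < θ (suc j) → m ≢ θ j → β m ≡ β′ m) →
                 z ≢ ones (θ j) → length z < θ (suc j) → language β z ≡ language β′ z
language-off-θ j {β} {β′} z agree z≢ z<θ with parse z in eq
... | junk    = refl
... | bitOf m = agree m m<θ λ { refl → z≢ (parse⁻¹-bitOf z eq) }
  where m<θ = ≤-<-trans (≤-reflexive (trans (sym (length-replicate m))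
                          (cong length (sym (parse⁻¹-bitOf z eq))))) z<θ
... | simulate c N e x = simulate-cong oracle oracle β β′ c N e x λ w w≤ →
  oracle-local N w w≤ (update-agree (cur N) c λ n n≤N n≢cur →
    let N<θ = <-trans (parse-simulate-< z eq) z<θ in
    -- If `θ j ≤ N < θ (suc j)` then `cur N` is `θ j`, so the one position of disagreement is
    -- overwritten.
    agree n (≤-<-trans n≤N N<θ) λ { refl → n≢cur (sym (cur-θ j N n≤N N<θ)) })

¬autoreducible : ¬ AutoreducibleRelativeTo (oracle limit) (language limit)
¬autoreducible (M , (k , fast) , decides , unasked) = not-¬ {x = language limit x} refl contra
  where
  -- A late enough occurrence of `M`, so that `polyBound-θ` applies.
  covering = machineAt-covers M (4 + k)
  j        = proj₁ covering
  4+k≤j    = proj₁ (proj₂ covering)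
  M≈       = proj₂ (proj₂ covering)
  x        = ones (θ j)
  T        = polyBound k (length x)
  T′       = 2 ^ (θ j ∸ 1)
  O        = oracle limit ∷ language limit ∷ []
  Oⱼ       = oracle (stage j) ∷ language (stage j) ∷ []

  1≤j : 1 ≤ j
  1≤j = ≤-trans (s≤s z≤n) 4+k≤j

  T≤T′ : T ≤ T′
  T≤T′ = subst (λ n → polyBound k n ≤ T′) (sym (length-replicate (θ j))) (polyBound-θ k j 4+k≤j)

  agree : ∀ i w → Queries M O x i w → length w ≤ T → lookup O i w ≡ lookup Oⱼ i w
  -- Reachable words of `B` see only bits up to `θ j ∸ 1`, where `stage j` is already final.
  agree zero w _ w≤T = oracle-local (θ j ∸ 1) w (≤-trans w≤T T≤T′) λ m m≤ →
    limit-stage {j} (≤-<-trans m≤ (∸-monoʳ-< {θ j} {1} {0} (s≤s z≤n) (≤-trans 1≤j (n≤θn j))))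
  agree (suc zero) w asked w≤T =
    language-off-θ j w (λ m → limit-off-θ {j} {m}) (λ { refl → unasked (language limit) x asked })
      (≤-<-trans (≤-trans w≤T T≤T′) (2^[θ∸1]<θ j 1≤j))

  halts : ∀ X → HaltsAt M (oracle limit ∷ X ∷ []) x T (proj₁ (fast X x))
  halts X = proj₂ (fast X x)

  haltsⱼ : HaltsAt M Oⱼ x T (proj₁ (fast (language limit) x))
  -- `fast` concerns the oracle `oracle limit` only; halting is carried over to `stage j` along the
  -- equality of configurations.
  haltsⱼ = trans (cong (nextAction M) (sym (configAt-cong M O Oⱼ x T agree T ≤-refl)))
                 (halts (language limit))

  contra : language limit x ≡ not (language limit x)
  contra = begin
    language limit x                       ≡⟨ cong (interpret oracle limit) (parse-ones (θ j)) ⟩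
    limit (θ j)                            ≡⟨ limit-θ j ⟩
    not (outcome (machineAt 1 j) Oⱼ x T′)  ≡⟨ cong not (outcome-≈ M≈ Oⱼ x T′) ⟩
    not (outcome M Oⱼ x T′)                ≡⟨ cong not (halts⇒outcome M Oⱼ x T T′ T≤T′ haltsⱼ) ⟩
    not (proj₁ (fast (language limit) x))  ≡⟨ cong not (halts⇒outcome M O x T T ≤-refl (halts (language limit))) ⟨
    not (outcome M O x T)                  ≡⟨ cong not (decided-outcome M O x T (proj₁ (decides x))
                                                (halts (language limit)) (proj₂ (decides x))) ⟩
    not (language limit x)                 ∎
    where open ≡-Reasoning

-- Stack programs

module _ {g : ℕ} where

  keep : ∀ {n} → Vec (Symbol g) n → Vec (Symbol g × Move) n
  keep = map (_, stay)

  zipWith-keep : ∀ {n} (ts : Vec (Tape g) n) → zipWith writeMove (keep (map scanned ts)) ts ≡ ts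
  zipWith-keep []       = refl
  zipWith-keep (t ∷ ts) = cong (t ∷_) (zipWith-keep ts)

  zipWith-keep-update : ∀ {n} (ts : Vec (Tape g) n) i f →
    zipWith writeMove (keep (map scanned ts) [ i ]%= f) ts ≡
    ts [ i ]%= (λ t → writeMove (f (scanned t , stay)) t)
  zipWith-keep-update (t ∷ ts) zero    f = cong (_ ∷_) (zipWith-keep ts)
  zipWith-keep-update (t ∷ ts) (suc i) f = cong (t ∷_) (zipWith-keep-update ts i f)

  -- A machine step writes before it moves, so a push takes two steps; the second overwrites
  -- whatever an earlier pop left in the cell.
  wordAtHead-push : ∀ b (t : Tape g) →
    wordAtHead (writeMove (bit b , stay) (moveHead left t)) ≡ b ∷ wordAtHead t
  wordAtHead-push b (tape []      s r) = refl
  wordAtHead-push b (tape (_ ∷ _) s r) = refl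

  wordAtHead-pop : ∀ {b w} (t : Tape g) → wordAtHead t ≡ b ∷ w → wordAtHead (moveHead right t) ≡ w
  wordAtHead-pop (tape l (bit b) [])      refl = refl
  wordAtHead-pop (tape l (bit b) (a ∷ r)) refl = refl

  wordAtHead-inputTape : ∀ x → wordAtHead (inputTape {g} x) ≡ x
  wordAtHead-inputTape []      = refl
  wordAtHead-inputTape (b ∷ x) = cong (b ∷_) (bits x)
    where
    bits : ∀ x → leadingBits (Data.List.map (bit {g}) x) ≡ x
    bits []      = refl
    bits (b ∷ x) = cong (b ∷_) (bits x)

-- Programs over T stacks of bits.  A stack is a tape whose contents are the word
-- at the head, with the top of the stack under the head.
data Prog (T : ℕ) : Set where
  skip    : Prog T
  push    : Fin T → Bool → Prog T
  _⨾_     : Prog T → Prog T → Prog T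
  while   : Fin T → (Bool → Prog T) → Prog T
  ifEmpty : Fin T → Prog T → Prog T → Prog T
  ask     : Prog T → Prog T → Prog T

infixr 5 _⨾_

Stacks : ℕ → Set
Stacks T = Vec Word T

-- while and ifEmpty pop one bit whenever the stack is not empty; ask queries the
-- word on stack 1.  The numbers bound the machine steps and count the queries.
data Exec {w : ℕ} (X : Language) : Prog (2 + w) → Stacks (2 + w) → Stacks (2 + w) → ℕ → ℕ → Set where
  skip : ∀ {σ} → Exec X skip σ σ 0 0
  push : ∀ {i b σ} → Exec X (push i b) σ (σ [ i ]%= (b ∷_)) 2 0
  _⨾_  : ∀ {p q σ σ′ σ″ c c′ k k′} →
         Exec X p σ σ′ c k → Exec X q σ′ σ″ c′ k′ → Exec X (p ⨾ q) σ σ″ (c + c′) (k + k′)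
  done : ∀ {i p σ} → lookup σ i ≡ [] → Exec X (while i p) σ σ 1 0
  loop : ∀ {i p b v σ σ′ σ″ c c′ k k′} → lookup σ i ≡ b ∷ v →
         Exec X (p b) (σ [ i ]≔ v) σ′ c k → Exec X (while i p) σ′ σ″ c′ k′ →
         Exec X (while i p) σ σ″ (suc (c + c′)) (k + k′)
  none : ∀ {i p q σ σ′ c k} → lookup σ i ≡ [] →
         Exec X p σ σ′ c k → Exec X (ifEmpty i p q) σ σ′ (suc c) k
  some : ∀ {i p q b v σ σ′ c k} → lookup σ i ≡ b ∷ v →
         Exec X q (σ [ i ]≔ v) σ′ c k → Exec X (ifEmpty i p q) σ σ′ (suc c) k
  ask  : ∀ {p q σ σ′ c k} →
         Exec X (if X (lookup σ (suc zero)) then p else q) σ σ′ c k →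
         Exec X (ask p q) σ σ′ (suc c) (suc k)
  within : ∀ {p σ σ′ c c′ k} → c ≤ c′ → Exec X p σ σ′ c k → Exec X p σ σ′ c′ k

-- Compilation of stack programs

data Instr (T : ℕ) (L : Set) : Set where
  shift   : Fin T → L → Instr T L
  write   : Fin T → Bool → L → Instr T L
  pop     : Fin T → (onEmpty : L) → (Bool → L) → Instr T L
  consult : (ifYes ifNo : L) → Instr T L
  stop    : Bool → Instr T L

size : ∀ {T} → Prog T → ℕ
size skip            = 0
size (push _ _)      = 2
size (p ⨾ q)         = size p + size q
size (while _ p)     = suc (size (p false) + size (p true))
size (ifEmpty _ p q) = suc (size p + size q)
size (ask p q)       = suc (size p + size q)

module _ {T : ℕ} {L : Set} where

  -- `at` places the instructions of `p` among the labels and `exit` is the label that follows;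
  -- `skip` occupies no label, so it is entered at its exit.
  entry : (p : Prog T) → (Fin (size p) → L) → L → L
  entry skip            at exit = exit
  entry (push _ _)      at exit = at zero
  entry (p ⨾ q)         at exit =
    entry p (at ∘ (_↑ˡ size q)) (entry q (at ∘ (size p ↑ʳ_)) exit)
  entry (while _ _)     at exit = at zero
  entry (ifEmpty _ _ _) at exit = at zero
  entry (ask _ _)       at exit = at zero

  code : (p : Prog T) → (Fin (size p) → L) → L → Fin (size p) → Instr T L
  code₂ : (p q : Prog T) → (Fin (size p + size q) → L) → L → L → Fin (size p + size q) → Instr T L

  code₂ p q at exit exit′ l =
    [ code p (at ∘ (_↑ˡ size q)) exit , code q (at ∘ (size p ↑ʳ_)) exit′ ]′ (splitAt (size p) l)

  code (push i b) at exit zero       = shift i (at (suc zero))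
  code (push i b) at exit (suc zero) = write i b exit
  code (p ⨾ q) at exit l             =
    code₂ p q at (entry q (at ∘ (size p ↑ʳ_)) exit) exit l
  code (while i p) at exit zero      = pop i exit λ where
    false → entry (p false) (at ∘ suc ∘ (_↑ˡ size (p true))) (at zero)
    true  → entry (p true) (at ∘ suc ∘ (size (p false) ↑ʳ_)) (at zero)
  code (while i p) at exit (suc l)   = code₂ (p false) (p true) (at ∘ suc) (at zero) (at zero) l
  code (ifEmpty i p q) at exit zero  =
    pop i (entry p (at ∘ suc ∘ (_↑ˡ size q)) exit)
          (const (entry q (at ∘ suc ∘ (size p ↑ʳ_)) exit))
  code (ifEmpty i p q) at exit (suc l) = code₂ p q (at ∘ suc) exit exit l
  code (ask p q) at exit zero        =
    consult (entry p (at ∘ suc ∘ (_↑ˡ size q)) exit)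
            (entry q (at ∘ suc ∘ (size p ↑ʳ_)) exit)
  code (ask p q) at exit (suc l)     = code₂ p q (at ∘ suc) exit exit l

  module _ (fetch : L → Instr T L) where

    Loaded : (p : Prog T) → (Fin (size p) → L) → L → Set
    Loaded p at exit = ∀ l → fetch (at l) ≡ code p at exit l

    module _ (p q : Prog T) (at : Fin (size p + size q) → L) {exit exit′ : L}
             (loaded : ∀ l → fetch (at l) ≡ code₂ p q at exit exit′ l) where

      loadedˡ : Loaded p (at ∘ (_↑ˡ size q)) exit
      loadedˡ l = trans (loaded (l ↑ˡ size q)) (cong [ _ , _ ]′ (splitAt-↑ˡ (size p) l (size q)))

      loadedʳ : Loaded q (at ∘ (size p ↑ʳ_)) exit′
      loadedʳ l = trans (loaded (size p ↑ʳ l)) (cong [ _ , _ ]′ (splitAt-↑ʳ (size p) (size q) l))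

module _ {w s : ℕ} where

  popAction : Fin (2 + w) → Fin s → (Bool → Fin s) → Vec (Symbol 0) (2 + w) → Symbol 0 →
              Action 1 s (2 + w) 0
  popAction i l ls v (bit b) = continue (ls b) (keep v [ i ]%= λ (s , _) → s , right)
  popAction i l ls v blank   = continue l (keep v)

  action : Instr (2 + w) (Fin s) → Vec (Symbol 0) (2 + w) → Action 1 s (2 + w) 0
  action (shift i l)      v = continue l (keep v [ i ]%= λ (s , _) → s , left)
  action (write i b l)    v = continue l (keep v [ i ]%= λ _ → bit b , stay)
  action (pop i l ls)     v = popAction i l ls v (lookup v i)
  action (consult y n)    v = query zero y n
  action (stop b)         v = halt b

module _ {m : ℕ} (M : OracleTM m) (O : Vec Language m) (x : Word) where

  queryCount-step : ∀ t → queryCount M O x t ≤ queryCount M O x (suc t)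
  queryCount-step t = m≤m+n _ _

  queryCount-halted : ∀ {u b} → HaltsAt M O x u b → ∀ t → queryCount M O x t ≤ queryCount M O x u
  queryCount-halted {u} {b} h t with ≤-total t u
  ... | inj₁ t≤u = rising (≤⇒≤′ t≤u)
    where
    rising : ∀ {u} → t ≤′ u → queryCount M O x t ≤ queryCount M O x u
    rising ≤′-refl         = ≤-refl
    rising (≤′-step {u} p) = ≤-trans (rising p) (queryCount-step u)
  ... | inj₂ u≤t = constant (≤⇒≤′ u≤t)
    where
    constant : ∀ {t} → u ≤′ t → queryCount M O x t ≤ queryCount M O x u
    constant ≤′-refl = ≤-refl
    constant (≤′-step {t} p)
      rewrite halts-later M O x {u} {t} {b} (≤′⇒≤ p) h
            | +-identityʳ (queryCount M O x t) = constant p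

module Compile {w : ℕ} (p : Prog (2 + w)) where

  Loc : Set
  Loc = Fin (3 + size p)

  bodyAt : Fin (size p) → Loc
  bodyAt l = suc (suc (suc l))

  fetch : Loc → Instr (2 + w) Loc
  fetch zero                = consult (suc zero) (suc (suc zero))
  fetch (suc zero)          = stop true
  fetch (suc (suc zero))    = stop false
  fetch (suc (suc (suc l))) = code p bodyAt zero l

  compiled : OracleTM 1
  compiled = machine (3 + size p) w 0 (entry p bodyAt zero) (λ q → action (fetch q))

  module _ (X : Language) (x : Word) where

    private
      O : Vec Language 1
      O = X ∷ []
      cfg : ℕ → Config compiled
      cfg = configAt compiled O x

      tapesAt : ℕ → Vec (Tape 0) (2 + w)
      tapesAt t = Config.contents (cfg t)

    record Reached (t : ℕ) (l : Loc) (σ : Stacks (2 + w)) (k : ℕ) : Set where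
      constructor reached
      field
        location : Config.state (cfg t) ≡ l
        stacks   : map wordAtHead (tapesAt t) ≡ σ
        asked    : queryCount compiled O x t ≡ k

    nextAction-fetch : ∀ {t l σ k i} → Reached t l σ k → fetch l ≡ i →
                       nextAction compiled (cfg t) ≡ action i (map scanned (tapesAt t))
    nextAction-fetch (reached refl _ _) refl = refl

    continued : ∀ {t l σ k i l′ σ′ ws} → Reached t l σ k → fetch l ≡ i →
      action i (map scanned (tapesAt t)) ≡ continue l′ ws →
      map wordAtHead (zipWith writeMove ws (tapesAt t)) ≡ σ′ → Reached (suc t) l′ σ′ k
    continued {t} {k = k} R fl eq words
      with e ← trans (nextAction-fetch R fl) eq =
      reached (cong (λ a → Config.state (perform compiled O a (cfg t))) e)
              (trans (cong (λ a → map wordAtHead (Config.contents (perform compiled O a (cfg t)))) e) words)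
              (trans (cong (λ a → queryCount compiled O x t + isQuery compiled a) e)
                     (trans (+-identityʳ _) (Reached.asked R)))

    wordAt : ∀ {t l σ k} → Reached t l σ k → ∀ i → wordAtHead (lookup (tapesAt t) i) ≡ lookup σ i
    wordAt {t} (reached _ refl _) i = sym (lookup-map i wordAtHead (tapesAt t))

    run-push : ∀ {t l l′ l″ σ k i b} → Reached t l σ k →
               fetch l ≡ shift i l′ → fetch l′ ≡ write i b l″ →
               Reached (2 + t) l″ (σ [ i ]%= (b ∷_)) k
    run-push {t} {i = i} {b} R fl fl′ = continued R′ fl′ refl (begin
        map wordAtHead (zipWith writeMove (keep (map scanned (tapesAt (suc t))) [ i ]%= _) (tapesAt (suc t)))
          ≡⟨ cong (map wordAtHead) (zipWith-keep-update (tapesAt (suc t)) i _) ⟩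
        map wordAtHead (tapesAt (suc t) [ i ]%= writeBit)
          ≡⟨ cong (λ ts → map wordAtHead (ts [ i ]%= writeBit)) shifted ⟩
        map wordAtHead ((tapesAt t [ i ]%= moveHead left) [ i ]%= writeBit)
          ≡⟨ cong (map wordAtHead) (updateAt-updateAt i (tapesAt t)) ⟩
        map wordAtHead (tapesAt t [ i ]%= (writeBit ∘ moveHead left))
          ≡⟨ map-updateAt (tapesAt t) i (wordAtHead-push b (lookup (tapesAt t) i)) ⟩
        map wordAtHead (tapesAt t) [ i ]%= (b ∷_)
          ≡⟨ cong (_[ i ]%= (b ∷_)) (Reached.stacks R) ⟩
        _ ∎)
      where
      open ≡-Reasoning
      writeBit : Tape 0 → Tape 0
      writeBit t = writeMove (bit b , stay) t
      R′ : Reached (suc t) _ _ _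
      R′ = continued R fl refl refl
      shifted : tapesAt (suc t) ≡ tapesAt t [ i ]%= moveHead left
      shifted = trans (cong (λ a → Config.contents (perform compiled O a (cfg t))) (nextAction-fetch R fl))
                      (zipWith-keep-update (tapesAt t) i _)

    run-pop-[] : ∀ {t l l′ ls σ k i} → Reached t l σ k → fetch l ≡ pop i l′ ls →
                 lookup σ i ≡ [] → Reached (suc t) l′ σ k
    run-pop-[] {t} {l′ = l′} {ls} {i = i} R fl empty = continued R fl popped
      (trans (cong (map wordAtHead) (zipWith-keep (tapesAt t))) (Reached.stacks R))
      where
      noBit : ∀ tp → wordAtHead tp ≡ [] →
              popAction i l′ ls (map scanned (tapesAt t)) (scanned tp) ≡
              continue l′ (keep (map scanned (tapesAt t)))
      noBit (tape _ blank _) _ = refl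
      popped : action (pop i l′ ls) (map scanned (tapesAt t)) ≡ _
      popped = trans (cong (popAction i l′ ls _) (lookup-map i scanned (tapesAt t)))
                     (noBit (lookup (tapesAt t) i) (trans (wordAt R i) empty))

    run-pop-∷ : ∀ {t l l′ ls σ k i b v} → Reached t l σ k → fetch l ≡ pop i l′ ls →
                lookup σ i ≡ b ∷ v → Reached (suc t) (ls b) (σ [ i ]≔ v) k
    run-pop-∷ {t} {l′ = l′} {ls} {i = i} {b} {v} R fl nonempty = continued R fl popped (begin
        map wordAtHead (zipWith writeMove (keep (map scanned (tapesAt t)) [ i ]%= _) (tapesAt t))
          ≡⟨ cong (map wordAtHead) (zipWith-keep-update (tapesAt t) i _) ⟩
        map wordAtHead (tapesAt t [ i ]%= moveHead right)
          ≡⟨ map-updateAt (tapesAt t) i (wordAtHead-pop _ here) ⟩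
        map wordAtHead (tapesAt t) [ i ]≔ v
          ≡⟨ cong (_[ i ]≔ v) (Reached.stacks R) ⟩
        _ ∎)
      where
      open ≡-Reasoning
      here : wordAtHead (lookup (tapesAt t) i) ≡ b ∷ v
      here = trans (wordAt R i) nonempty
      aBit : ∀ tp → wordAtHead tp ≡ b ∷ v →
             popAction i l′ ls (map scanned (tapesAt t)) (scanned tp) ≡
             continue (ls b) (keep (map scanned (tapesAt t)) [ i ]%= λ (s , _) → s , right)
      aBit (tape _ (bit _) _) refl = refl
      popped : action (pop i l′ ls) (map scanned (tapesAt t)) ≡ _
      popped = trans (cong (popAction i l′ ls _) (lookup-map i scanned (tapesAt t))) (aBit (lookup (tapesAt t) i) here)

    run-consult : ∀ {t l y n σ k} → Reached t l σ k → fetch l ≡ consult y n →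
                  Reached (suc t) (if X (lookup σ (suc zero)) then y else n) σ (suc k)
    run-consult {t} {y = y} {n} {σ} R fl with e ← nextAction-fetch R fl =
      reached (trans (cong (λ a → Config.state (perform compiled O a (cfg t))) e)
                     (cong (λ v → if X v then y else n) (wordAt R (suc zero))))
              (trans (cong (λ a → map wordAtHead (Config.contents (perform compiled O a (cfg t)))) e)
                     (Reached.stacks R))
              (trans (cong (λ a → queryCount compiled O x t + isQuery compiled a) e)
                     (trans (+-comm _ 1) (cong suc (Reached.asked R))))

    reached-+ : ∀ k k′ {k₀ t l σ} → Reached t l σ (k′ + (k + k₀)) → Reached t l σ (k + k′ + k₀)
    reached-+ k k′ {k₀} = subst (Reached _ _ _)
      (trans (sym (+-assoc k′ k k₀)) (cong (_+ k₀) (+-comm k′ k)))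

    add-costs : ∀ c c′ {t t₁ t₂} → t₁ ≤ c + t → t₂ ≤ c′ + t₁ → t₂ ≤ c + c′ + t
    add-costs c c′ {t} h₁ h₂ = ≤-trans h₂ (≤-trans (+-monoʳ-≤ c′ h₁) (≤-reflexive
      (trans (sym (+-assoc c′ c t)) (cong (_+ t) (+-comm c′ c)))))

    -- The time is only bounded, since `within` may overstate a cost, whereas queries are counted
    -- exactly.
    sound : ∀ {q at exit σ σ′ c k₀ k t} → Exec X q σ σ′ c k → Loaded fetch q at exit →
            Reached t (entry q at exit) σ k₀ →
            ∃[ t′ ] (t′ ≤ c + t × Reached t′ exit σ′ (k + k₀))

    sound-if : ∀ b (q r : Prog (2 + w)) {at} {exit : Loc} {σ σ′ c k₀ k t} →
               Exec X (if b then q else r) σ σ′ c k →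
               (∀ l → fetch (at l) ≡ code₂ q r at exit exit l) →
               Reached t (if b then entry q (at ∘ (_↑ˡ size r)) exit
                               else entry r (at ∘ (size q ↑ʳ_)) exit) σ k₀ →
               ∃[ t′ ] (t′ ≤ c + t × Reached t′ exit σ′ (k + k₀))
    sound-if true  q r {at} d loaded = sound d (loadedˡ fetch q r at loaded)
    sound-if false q r {at} d loaded = sound d (loadedʳ fetch q r at loaded)

    sound-loop : ∀ {i p at exit σ σ′ c c′ k₀ k k′ t} →
                 Exec X (while i p) σ σ′ c′ k′ → Loaded fetch (while i p) at exit →
                 ∃[ t′ ] (t′ ≤ c + suc t × Reached t′ (at zero) σ (k + k₀)) →
                 ∃[ t′ ] (t′ ≤ suc (c + c′ + t) × Reached t′ exit σ′ (k + k′ + k₀))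
    sound-loop {c = c} {c′} {k = k} {k′} {t} e loaded (t₁ , t₁≤ , R₁) =
      let t₂ , t₂≤ , R₂ = sound e loaded R₁
      in t₂ , ≤-trans (add-costs c c′ t₁≤ t₂≤) (≤-reflexive (+-suc (c + c′) t)) , reached-+ k k′ R₂

    later : ∀ {c t exit σ k} → ∃[ t′ ] (t′ ≤ c + suc t × Reached t′ exit σ k) →
            ∃[ t′ ] (t′ ≤ suc (c + t) × Reached t′ exit σ k)
    later {c} {t} (t′ , t′≤ , R) = t′ , ≤-trans t′≤ (≤-reflexive (+-suc c t)) , R

    sound skip loaded R = _ , ≤-refl , R
    sound push loaded R = _ , ≤-refl , run-push R (loaded zero) (loaded (suc zero))
    sound {at = at} (_⨾_ {p} {q} {c = c} {c′} {k} {k′} d e) loaded R =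
      let t₁ , le₁ , R₁ = sound d (loadedˡ fetch p q at loaded) R
          t₂ , le₂ , R₂ = sound e (loadedʳ fetch p q at loaded) R₁
      in t₂ , add-costs c c′ le₁ le₂ , reached-+ k k′ R₂
    sound (done empty) loaded R = _ , ≤-refl , run-pop-[] R (loaded zero) empty
    sound {at = at} (loop {i} {p} {false} {c = c} {k = k} eq d e) loaded R =
      sound-loop {i} {p} {c = c} {k = k} e loaded
        (sound d (loadedˡ fetch (p false) (p true) (at ∘ suc) (loaded ∘ suc)) (run-pop-∷ R (loaded zero) eq))
    sound {at = at} (loop {i} {p} {true} {c = c} {k = k} eq d e) loaded R =
      sound-loop {i} {p} {c = c} {k = k} e loaded
        (sound d (loadedʳ fetch (p false) (p true) (at ∘ suc) (loaded ∘ suc)) (run-pop-∷ R (loaded zero) eq))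
    sound {at = at} (none {p = p} {q} eq d) loaded R =
      later {_} (sound d (loadedˡ fetch p q (at ∘ suc) (loaded ∘ suc)) (run-pop-[] R (loaded zero) eq))
    sound {at = at} (some {p = p} {q} eq d) loaded R =
      later {_} (sound d (loadedʳ fetch p q (at ∘ suc) (loaded ∘ suc)) (run-pop-∷ R (loaded zero) eq))
    sound {at = at} {k₀ = k₀} (ask {p} {q} {c = c} {k} d) loaded R =
      let t′ , t′≤ , R′ = later {c} (sound-if _ p q {at ∘ suc} d (loaded ∘ suc) (run-consult R (loaded zero)))
      in t′ , t′≤ , subst (Reached _ _ _) (+-suc k k₀) R′
    sound (within c≤c′ d) loaded R =
      let t′ , t′≤ , R′ = sound d loaded R in t′ , ≤-trans t′≤ (+-monoˡ-≤ _ c≤c′) , R′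

    initially : Reached 0 (entry p bodyAt zero) (x ∷ replicate _ []) 0
    initially = reached refl
      (cong₂ _∷_ (wordAtHead-inputTape x) (map-replicate wordAtHead emptyTape (1 + w))) refl

    -- The machine ends by querying stack 1 and returning the answer.
    compiled-halts : ∀ {σ c k} → Exec X p (x ∷ replicate _ []) σ c k → ∀ {f} → 1 + c ≤ f →
      HaltsAt compiled O x f (X (lookup σ (suc zero))) ×
      (∀ t → queryCount compiled O x t ≤ suc k)
    compiled-halts {σ} {c} {k} d {f} c<f =
      let t , t≤ , R = sound d (λ _ → refl) initially
          R′ = run-consult R refl
          h  = halted (X (lookup σ (suc zero))) R′
      in halts-later compiled O x {suc t} (≤-trans (s≤s (≤-trans t≤ (≤-reflexive (+-identityʳ c)))) c<f) h ,
         λ t′ → ≤-trans (queryCount-halted compiled O x {suc t} h t′)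
                        (≤-reflexive (trans (Reached.asked R′) (cong suc (+-identityʳ k))))
      where
      halted : ∀ b {t σ k} → Reached t (if b then suc zero else suc (suc zero)) σ k →
               HaltsAt compiled O x t b
      halted true  R = nextAction-fetch R refl
      halted false R = nextAction-fetch R refl

-- Completeness

PolyBounded : (ℕ → ℕ) → Set
PolyBounded f = ∃[ k ] (∀ n → f n ≤ polyBound k n)

polyBound-small : ∀ k {n} → n ≤ 1 → polyBound k n ≤ suc k
polyBound-small zero    {zero}        _ = ≤-refl
polyBound-small (suc k) {zero}        _ = n≤1+n _
polyBound-small k       {suc zero}    _ = ≤-reflexive (cong (_+ k) (^-zeroˡ k))
polyBound-small k       {suc (suc n)} (s≤s ())

polyBound-large : ∀ k {n} → 2 ≤ n → polyBound k n ≤ n ^ suc k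
polyBound-large k {n} 2≤n = begin
  n ^ k + k     ≤⟨ +-monoʳ-≤ (n ^ k) (≤-trans (<⇒≤ (n<2^n k)) (^-monoˡ-≤ k 2≤n)) ⟩
  n ^ k + n ^ k ≡⟨ cong (n ^ k +_) (+-identityʳ (n ^ k)) ⟨
  2 * n ^ k     ≤⟨ *-monoˡ-≤ (n ^ k) 2≤n ⟩
  n * n ^ k     ∎
  where open ≤-Reasoning

^-mono-exponent : ∀ {n i j} → 2 ≤ n → i ≤ j → n ^ i ≤ n ^ j
^-mono-exponent {suc n} _ = ^-monoʳ-≤ (suc n)

-- From 2 on, a summand can be absorbed by raising the exponent; at 0 and 1 powers do not grow, and
-- the additive constant of `polyBound` has to serve.
polyBounded-split : ∀ {f} i j → (∀ n → n ≤ 1 → f n ≤ i) → (∀ n → 2 ≤ n → f n ≤ n ^ j) → PolyBounded f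
polyBounded-split {f} i j small large = i + j , bound
  where
  bound : ∀ n → f n ≤ polyBound (i + j) n
  bound n with ≤-<-connex n 1
  ... | inj₁ n≤1 = ≤-trans (small n n≤1) (≤-trans (m≤m+n i j) (m≤n+m (i + j) (n ^ (i + j))))
  ... | inj₂ 2≤n = ≤-trans (large n 2≤n) (≤-trans (^-mono-exponent 2≤n (m≤n+m j i)) (m≤m+n _ (i + j)))

polyBounded-const : ∀ c → PolyBounded (const c)
polyBounded-const c = c , λ n → m≤n+m c (n ^ c)

polyBounded-id : PolyBounded (λ n → n)
polyBounded-id = 1 , λ n → ≤-trans (≤-reflexive (sym (*-identityʳ n))) (m≤m+n _ 1)

polyBounded-+ : ∀ {f g} → PolyBounded f → PolyBounded g → PolyBounded (λ n → f n + g n)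
polyBounded-+ {f} {g} (k , f≤) (l , g≤) = polyBounded-split (suc k + suc l) (suc (suc k + suc l))
  (λ n n≤1 → +-mono-≤ (≤-trans (f≤ n) (polyBound-small k n≤1)) (≤-trans (g≤ n) (polyBound-small l n≤1)))
  λ n 2≤n → let open ≤-Reasoning in begin
    f n + g n                     ≤⟨ +-mono-≤ (≤-trans (f≤ n) (polyBound-large k 2≤n))
                                              (≤-trans (g≤ n) (polyBound-large l 2≤n)) ⟩
    n ^ suc k + n ^ suc l         ≤⟨ +-mono-≤ (^-mono-exponent 2≤n (m≤m+n (suc k) (suc l)))
                                              (^-mono-exponent 2≤n (m≤n+m (suc l) (suc k))) ⟩
    n ^ (suc k + suc l) + n ^ (suc k + suc l) ≡⟨ cong (n ^ (suc k + suc l) +_) (+-identityʳ _) ⟨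
    2 * n ^ (suc k + suc l)       ≤⟨ *-monoˡ-≤ _ 2≤n ⟩
    n ^ suc (suc k + suc l)       ∎

polyBounded-* : ∀ {f g} → PolyBounded f → PolyBounded g → PolyBounded (λ n → f n * g n)
polyBounded-* (k , f≤) (l , g≤) = polyBounded-split (suc k * suc l) (suc k + suc l)
  (λ n n≤1 → *-mono-≤ (≤-trans (f≤ n) (polyBound-small k n≤1)) (≤-trans (g≤ n) (polyBound-small l n≤1)))
  λ n 2≤n → ≤-trans (*-mono-≤ (≤-trans (f≤ n) (polyBound-large k 2≤n)) (≤-trans (g≤ n) (polyBound-large l 2≤n)))
                    (≤-reflexive (sym (^-distribˡ-+-* n (suc k) (suc l))))

polyBounded-^ : ∀ {f} → PolyBounded f → ∀ k → PolyBounded (λ n → f n ^ k)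
polyBounded-^ F zero    = polyBounded-const 1
polyBounded-^ F (suc k) = polyBounded-* F (polyBounded-^ F k)

pushes : ∀ {T} → Fin T → ℕ → Prog T
pushes i zero    = skip
pushes i (suc n) = pushes i n ⨾ push i true

module _ {w : ℕ} {X : Language} where

  -- The loop invariant S speaks about the bits still to be read and those already
  -- read, most recent first.
  exec-while : ∀ {i p} (S : Word → Word → Stacks (2 + w)) c → (∀ v d → lookup (S v d) i ≡ v) → ∀ v →
    (∀ b u d → suc (length u + length d) ≡ length v → Exec X (p b) (S (b ∷ u) d [ i ]≔ u) (S u (b ∷ d)) c 0) →
    Exec X (while i p) (S v []) (S [] (reverse v)) (1 + length v * suc c) 0
  exec-while {i} {p} S c at v body = go v [] (+-identityʳ (length v))
    where
    go : ∀ u d → length u + length d ≡ length v →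
         Exec X (while i p) (S u d) (S [] (u ʳ++ d)) (1 + length u * suc c) 0
    go []      d _  = done (at [] d)
    go (b ∷ u) d eq = within (≤-reflexive (cong suc (+-suc c _)))
      (loop (at (b ∷ u) d) (body b u d eq) (go u (b ∷ d) (trans (+-suc (length u) (length d)) eq)))

  exec-repeat : ∀ {i p} (S : ℕ → ℕ → Stacks (2 + w)) c → (∀ r d → lookup (S r d) i ≡ ones r) → ∀ n →
    (∀ r d → suc (r + d) ≡ n → Exec X (p true) (S (suc r) d [ i ]≔ ones r) (S r (suc d)) c 0) →
    Exec X (while i p) (S n 0) (S 0 n) (1 + n * suc c) 0
  exec-repeat {i} {p} S c at n body = subst (λ m → Exec X (while i p) (S n 0) (S 0 m) (1 + n * suc c) 0)
                                            (+-identityʳ n) (go n 0 (+-identityʳ n))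
    where
    go : ∀ r d → r + d ≡ n → Exec X (while i p) (S r d) (S 0 (r + d)) (1 + r * suc c) 0
    go zero    d _  = done (at 0 d)
    go (suc r) d eq = within (≤-reflexive (cong suc (+-suc c _)))
      (loop (at (suc r) d) (body r d eq)
        (subst (λ m → Exec X (while i p) (S r (suc d)) (S 0 m) (1 + r * suc c) 0)
               (+-suc r d) (go r (suc d) (trans (+-suc r d) eq))))

  exec-pushes : ∀ {i} (S : ℕ → Stacks (2 + w)) → (∀ d → S d [ i ]%= (true ∷_) ≡ S (suc d)) → ∀ n →
    Exec X (pushes i n) (S 0) (S n) (n * 2) 0
  exec-pushes S up zero    = skip
  exec-pushes S up (suc n) = within (≤-reflexive (+-comm (n * 2) 2))
    (exec-pushes S up n ⨾ subst (λ σ → Exec X (push _ true) (S n) σ 2 0) (up n) push)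

-- Stacks: input, query, copy of the input, counter, temporary counter.
double : Prog 5
double = while 3F (λ _ → push 4F true ⨾ push 4F true) ⨾ while 4F (λ _ → push 3F true)

-- The counter starts at one and doubles with every letter read. The input travels through stack 2
-- because moving a stack reverses it.
padding : Prog 5
padding = push 3F true ⨾
          while 0F (λ b → push 2F b ⨾ double) ⨾
          while 2F (push 1F) ⨾
          push 1F false ⨾
          while 3F (λ _ → push 1F true)

-- Mirrors the program: a push costs 2, and `n` rounds of a loop with body cost `c` cost
-- `1 + n * suc c`.
paddingCost : ℕ → ℕ
paddingCost n = 2 + (1 + n * suc (2 + (1 + 2 ^ n * 5 + (1 + 2 ^ n * 2 * 3))) +
                (1 + n * 3 + (2 + (1 + 2 ^ n * 3))))

exec-double : ∀ {X} x q d n →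
  Exec X double (x ∷ q ∷ d ∷ ones n ∷ [] ∷ []) (x ∷ q ∷ d ∷ ones (n * 2) ∷ [] ∷ [])
       (1 + n * 5 + (1 + n * 2 * 3)) 0
exec-double x q d n =
  exec-repeat (λ r m → x ∷ q ∷ d ∷ ones r ∷ ones (m * 2) ∷ []) 4 (λ _ _ → refl) n (λ _ _ _ → push ⨾ push) ⨾
  exec-repeat (λ r m → x ∷ q ∷ d ∷ ones m ∷ ones r ∷ []) 2 (λ _ _ → refl) (n * 2) (λ _ _ _ → push)

exec-padding : ∀ {X} x → ∃[ σ ] (Exec X padding (x ∷ replicate 4 []) σ (paddingCost (length x)) 0 ×
                                  lookup σ 1F ≡ unary (2 ^ length x) x)
exec-padding {X} x = _ ,
  (push ⨾
   exec-while (λ v d → v ∷ [] ∷ d ∷ ones (2 ^ length d) ∷ [] ∷ []) _ (λ _ _ → refl) x copyAndDouble ⨾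
   subst (λ n → Exec X rest (state (reverse x) n) final (1 + length x * 3 + (2 + (1 + N * 3))) 0) (sym (length-reverse x)) copyBack) ,
  cong₂ unary refl (reverse-involutive x)
  where
  N = 2 ^ length x
  rest = while 2F (push 1F) ⨾ push 1F false ⨾ while 3F (λ _ → push 1F true)

  final : Stacks 5
  final = [] ∷ unary N (reverse (reverse x)) ∷ [] ∷ [] ∷ [] ∷ []

  state : Word → ℕ → Stacks 5
  state d n = [] ∷ [] ∷ d ∷ ones (2 ^ n) ∷ [] ∷ []

  copyAndDouble : ∀ b u d → suc (length u + length d) ≡ length x →
    Exec X (push 2F b ⨾ double) (u ∷ [] ∷ d ∷ ones (2 ^ length d) ∷ [] ∷ [])
         (u ∷ [] ∷ (b ∷ d) ∷ ones (2 ^ length (b ∷ d)) ∷ [] ∷ [])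
         (2 + (1 + N * 5 + (1 + N * 2 * 3))) 0
  -- `exec-while` charges all rounds alike, so each is charged for the final counter `N`.
  copyAndDouble b u d eq = push ⨾ within (+-mono-≤ (s≤s (*-monoˡ-≤ 5 D≤N)) (s≤s (*-monoˡ-≤ 3 (*-monoˡ-≤ 2 D≤N))))
    (subst (λ n → Exec X double (u ∷ [] ∷ (b ∷ d) ∷ ones D ∷ [] ∷ []) (u ∷ [] ∷ (b ∷ d) ∷ ones n ∷ [] ∷ [])
                          (1 + D * 5 + (1 + D * 2 * 3)) 0)
           (*-comm D 2) (exec-double u [] (b ∷ d) D))
    where
    D = 2 ^ length d
    D≤N : D ≤ N
    D≤N = ^-monoʳ-≤ 2 (≤-trans (m≤n+m (length d) (length u)) (≤-trans (n≤1+n _) (≤-reflexive eq)))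

  copyBack : Exec X rest (state (reverse x) (length x)) final
                  (1 + length x * 3 + (2 + (1 + N * 3))) 0
  copyBack =
    within (≤-reflexive (cong (λ n → 1 + n * 3) (length-reverse x)))
      (exec-while (λ v d → [] ∷ d ∷ v ∷ ones N ∷ [] ∷ []) 2 (λ _ _ → refl) (reverse x) (λ _ _ _ _ → push)) ⨾
    push ⨾
    exec-repeat (λ r m → [] ∷ (ones m ++ false ∷ reverse (reverse x)) ∷ [] ∷ ones r ∷ [] ∷ []) 2 (λ _ _ → refl) N
      (λ _ _ _ → push)

-- Exponential bounds and membership in `EXP`

ExpBounded : (ℕ → ℕ) → Set
ExpBounded f = ∃[ g ] (PolyBounded g × (∀ n → f n ≤ 2 ^ g n))

expBounded⇒expBound : ∀ {f} → ExpBounded f → ∃[ k ] (∀ n → f n ≤ expBound k n)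
expBounded⇒expBound (g , (k , g≤) , f≤) = k , λ n → ≤-trans (f≤ n) (^-monoʳ-≤ 2 (g≤ n))

expBounded-const : ∀ c → ExpBounded (const c)
expBounded-const c = const c , polyBounded-const c , λ _ → <⇒≤ (n<2^n c)

expBounded-id : ExpBounded (λ n → n)
expBounded-id = (λ n → n) , polyBounded-id , λ n → <⇒≤ (n<2^n n)

expBounded-2^ : ExpBounded (2 ^_)
expBounded-2^ = (λ n → n) , polyBounded-id , λ _ → ≤-refl

expBounded-* : ∀ {f g} → ExpBounded f → ExpBounded g → ExpBounded (λ n → f n * g n)
expBounded-* (a , A , f≤) (b , B , g≤) = (λ n → a n + b n) , polyBounded-+ A B , λ n →
  ≤-trans (*-mono-≤ (f≤ n) (g≤ n)) (≤-reflexive (sym (^-distribˡ-+-* 2 (a n) (b n))))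

expBounded-+ : ∀ {f g} → ExpBounded f → ExpBounded g → ExpBounded (λ n → f n + g n)
expBounded-+ (a , A , f≤) (b , B , g≤) =
  (λ n → 1 + (a n + b n)) , polyBounded-+ (polyBounded-const 1) (polyBounded-+ A B) , λ n →
  +-mono-≤ (≤-trans (f≤ n) (^-monoʳ-≤ 2 (m≤m+n (a n) (b n))))
           (≤-trans (g≤ n) (≤-trans (^-monoʳ-≤ 2 (m≤n+m (b n) (a n))) (m≤m+n _ 0)))

paddingCost-exponential : ExpBounded (λ n → 1 + paddingCost n)
paddingCost-exponential =
  lit 1 ⊕ (lit 2 ⊕ ((lit 1 ⊕ (expBounded-id ⊗ (lit 1 ⊕ (lit 2 ⊕ ((lit 1 ⊕ (expBounded-2^ ⊗ lit 5)) ⊕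
    (lit 1 ⊕ ((expBounded-2^ ⊗ lit 2) ⊗ lit 3))))))) ⊕
  ((lit 1 ⊕ (expBounded-id ⊗ lit 3)) ⊕ (lit 2 ⊕ (lit 1 ⊕ (expBounded-2^ ⊗ lit 3))))))
  where
  lit = expBounded-const
  infixr 6 _⊕_
  infixr 7 _⊗_
  _⊕_ = expBounded-+
  _⊗_ = expBounded-*

language∈EXP : ∀ β → language β ∈ EXP (oracle β)
language∈EXP β =
  let k , fits = expBounded⇒expBound paddingCost-exponential
      halts = λ x → let σ , d , q≡ = exec-padding x in
        subst (HaltsAt compiled (oracle β ∷ []) x (expBound k (length x)))
          (trans (cong (oracle β) q≡) (oracle-unary β (2 ^ length x) x ≤-refl))
          (proj₁ (compiled-halts (oracle β) x d (fits (length x))))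
  in compiled , k , (λ x → language β x , halts x) , λ x → expBound k (length x) , halts x
  where open Compile padding

-- Stacks: input, query, copy of the input, bound, temporary, units read, p and r
-- of the scan; the query stack also holds m.
multiply : Prog 8
multiply =
  while 0F (λ b → push 2F b ⨾
                  while 3F (λ _ → push 4F true ⨾ push 5F true) ⨾
                  while 4F (λ _ → push 3F true)) ⨾
  while 2F (push 0F) ⨾
  while 5F (λ _ → push 3F true)

powers : ℕ → Prog 8
powers zero    = push 3F true
powers (suc k) = powers k ⨾ multiply

-- The cases of `advance` with `p` zero. Reading a stack destroys it, so the units read are copied
-- by way of stack 4.
reload : Prog 8
reload =
  while 5F (λ _ → push 4F true) ⨾
  while 4F (λ _ → push 5F true ⨾ push 6F true) ⨾
  ifEmpty 7F
    (while 1F (λ _ → skip) ⨾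
     while 5F (λ _ → push 4F true) ⨾
     while 4F (λ _ → push 5F true ⨾ push 7F true ⨾ push 1F true))
    skip

-- The pop built into `ifEmpty` is the decrement of `p`, as it is of `r` in `reload`.
tick : Prog 8
tick = push 5F true ⨾ ifEmpty 6F reload skip

-- A stack fills from its bottom, so the request is assembled from `x` back to `c`; the units read
-- supply `N`, and stack 3 holds the first answer.
compose : ℕ → Prog 8
compose e =
  while 1F (λ _ → skip) ⨾
  while 0F (push 2F) ⨾
  while 2F (push 1F) ⨾
  push 1F false ⨾ pushes 1F e ⨾ push 1F false ⨾
  while 5F (λ _ → push 1F true) ⨾
  while 3F (push 1F)

reduction : ℕ → ℕ → Prog 8
reduction k e =
  powers k ⨾ pushes 3F k ⨾ while 3F (λ _ → tick) ⨾
  ask (push 3F true) (push 3F false) ⨾ compose e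

-- The base is `suc n` because `multiply` adds `n * a` to the `a` already present; any bound above
-- `polyBound k n` would serve.
bound : ℕ → ℕ → ℕ
bound k n = k + suc n ^ k

multiplyCost : ℕ → ℕ → ℕ
multiplyCost n a = 1 + n * suc (2 + (1 + a * 5 + (1 + a * 3))) + (1 + n * 3 + (1 + n * a * 3))

powersCost : ℕ → ℕ → ℕ
powersCost zero    n = 2
powersCost (suc k) n = powersCost k n + multiplyCost n (suc n ^ k)

tickCost : ℕ → ℕ
tickCost v = 2 + suc (1 + v * 3 + (1 + v * 5 + suc (1 + v * 1 + (1 + v * 3 + (1 + v * 7)))))

composeCost : ℕ → ℕ → ℕ → ℕ
composeCost e v n = 1 + v * 1 + (1 + n * 3 + (1 + n * 3 + (2 + (e * 2 + (2 + (1 + v * 3 + 4))))))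

reductionCost : ℕ → ℕ → ℕ → ℕ
reductionCost k e n = powersCost k n + (k * 2 + (1 + v * suc (tickCost v) + (3 + composeCost e v n)))
  where v = bound k n

-- Execution of the reduction

module _ {X : Language} where

  exec-multiply : ∀ x a → Exec X multiply
    (x ∷ [] ∷ [] ∷ ones a ∷ [] ∷ [] ∷ [] ∷ [] ∷ [])
    (x ∷ [] ∷ [] ∷ ones (length x * a + a) ∷ [] ∷ [] ∷ [] ∷ [] ∷ [])
    (multiplyCost (length x) a) 0
  exec-multiply x a =
    exec-while (λ v d → v ∷ [] ∷ d ∷ ones a ∷ [] ∷ ones (length d * a) ∷ [] ∷ [] ∷ []) _ (λ _ _ → refl) x
      (λ b u d _ → push ⨾
        exec-repeat (λ r m → u ∷ [] ∷ (b ∷ d) ∷ ones r ∷ ones m ∷ ones (m + length d * a) ∷ [] ∷ [] ∷ []) 4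
          (λ _ _ → refl) a (λ _ _ _ → push ⨾ push) ⨾
        exec-repeat (λ r m → u ∷ [] ∷ (b ∷ d) ∷ ones m ∷ ones r ∷ ones (a + length d * a) ∷ [] ∷ [] ∷ []) 2
          (λ _ _ → refl) a (λ _ _ _ → push)) ⨾
    subst₂ (λ y n → Exec X rest (state [] (reverse x) a (length (reverse x) * a)) (state y [] (n * a + a) 0) cost 0)
      (reverse-involutive x) (length-reverse x)
      (within (≤-reflexive (cong (λ n → 1 + n * 3 + (1 + n * a * 3)) (length-reverse x)))
      (exec-while (λ v d → state d v a (length (reverse x) * a)) 2 (λ _ _ → refl) (reverse x) (λ _ _ _ _ → push) ⨾
       exec-repeat (λ r m → state (reverse (reverse x)) [] (m + a) r) 2 (λ _ _ → refl) (length (reverse x) * a)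
         (λ _ _ _ → push)))
    where
    rest = while 2F (push 0F) ⨾ while 5F (λ _ → push 3F true)
    cost = 1 + length x * 3 + (1 + length x * a * 3)
    state : Word → Word → ℕ → ℕ → Stacks 8
    state y d a u = y ∷ [] ∷ d ∷ ones a ∷ [] ∷ ones u ∷ [] ∷ [] ∷ []

  exec-powers : ∀ x k → Exec X (powers k) (x ∷ replicate 7 [])
    (x ∷ [] ∷ [] ∷ ones (suc (length x) ^ k) ∷ [] ∷ [] ∷ [] ∷ [] ∷ [])
    (powersCost k (length x)) 0
  exec-powers x zero    = push
  exec-powers x (suc k) = exec-powers x k ⨾
    subst (λ v → Exec X multiply (x ∷ [] ∷ [] ∷ ones a ∷ [] ∷ [] ∷ [] ∷ [] ∷ [])
                      (x ∷ [] ∷ [] ∷ ones v ∷ [] ∷ [] ∷ [] ∷ [] ∷ []) (multiplyCost (length x) a) 0)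
          (+-comm (length x * a) a) (exec-multiply x a)
    where a = suc (length x) ^ k

  scanning : Word → ℕ → ℕ → Scan → Stacks 8
  scanning x v u (p , r , m) = x ∷ ones m ∷ [] ∷ ones v ∷ [] ∷ ones u ∷ ones p ∷ ones r ∷ []

  exec-repeat≤ : ∀ {i p} (S : ℕ → ℕ → Stacks 8) c → (∀ r d → lookup (S r d) i ≡ ones r) → ∀ {n N} → n ≤ N →
    (∀ r d → suc (r + d) ≡ n → Exec X (p true) (S (suc r) d [ i ]≔ ones r) (S r (suc d)) c 0) →
    Exec X (while i p) (S n 0) (S 0 n) (1 + N * suc c) 0
  exec-repeat≤ S c at {n} n≤N body = within (s≤s (*-monoˡ-≤ (suc c) n≤N)) (exec-repeat S c at n body)

  exec-tick : ∀ x v u s {N} → suc u ≤ N → proj₂ (proj₂ s) ≤ N →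
    Exec X tick (scanning x v u s) (scanning x v (suc u) (advance u s)) (tickCost N) 0
  exec-tick x v u (suc p , r , m) u<N m≤N = push ⨾ some refl (within z≤n skip)
  exec-tick x v u (zero , r , m) {N} u<N m≤N = push ⨾ none refl
    (exec-repeat≤ (λ i d → x ∷ ones m ∷ [] ∷ ones v ∷ ones d ∷ ones i ∷ [] ∷ ones r ∷ []) 2
       (λ _ _ → refl) u<N (λ _ _ _ → push) ⨾
     exec-repeat≤ (λ i d → x ∷ ones m ∷ [] ∷ ones v ∷ ones i ∷ ones d ∷ ones d ∷ ones r ∷ []) 4
       (λ _ _ → refl) u<N (λ _ _ _ → push ⨾ push) ⨾
     threshold r)
    where
    threshold : ∀ r → Exec X
      (ifEmpty 7F (while 1F (λ _ → skip) ⨾ while 5F (λ _ → push 4F true) ⨾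
                   while 4F (λ _ → push 5F true ⨾ push 7F true ⨾ push 1F true)) skip)
      (scanning x v (suc u) (suc u , r , m)) (scanning x v (suc u) (advance u (zero , r , m)))
      (suc (1 + N * 1 + (1 + N * 3 + (1 + N * 7)))) 0
    threshold (suc r) = some refl (within z≤n skip)
    threshold zero    = none refl
      (exec-repeat≤ (λ i d → x ∷ ones i ∷ [] ∷ ones v ∷ [] ∷ ones (suc u) ∷ ones (suc u) ∷ [] ∷ []) 0
         (λ _ _ → refl) m≤N (λ _ _ _ → skip) ⨾
       exec-repeat≤ (λ i d → x ∷ [] ∷ [] ∷ ones v ∷ ones d ∷ ones i ∷ ones (suc u) ∷ [] ∷ []) 2
         (λ _ _ → refl) u<N (λ _ _ _ → push) ⨾
       exec-repeat≤ (λ i d → x ∷ ones d ∷ [] ∷ ones v ∷ ones i ∷ ones d ∷ ones (suc u) ∷ ones d ∷ []) 6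
         (λ _ _ → refl) u<N (λ _ _ _ → push ⨾ push ⨾ push))

  exec-scan : ∀ x n → Exec X (while 3F (λ _ → tick)) (scanning x n 0 (scan 0)) (scanning x 0 n (scan n))
    (1 + n * suc (tickCost n)) 0
  exec-scan x n = exec-repeat (λ r d → scanning x r d (scan d)) (tickCost n) (λ _ _ → refl) n λ r d eq →
    let d<n = ≤-trans (s≤s (m≤n+m d r)) (≤-reflexive eq) in
    -- `cur≤` bounds the cost of clearing the old threshold from the query stack.
    exec-tick x r d (scan d) d<n (≤-trans (cur≤ d) (<⇒≤ d<n))

  exec-ask : ∀ x v p r m → Exec X (ask (push 3F true) (push 3F false)) (scanning x 0 v (p , r , m))
    (x ∷ ones m ∷ [] ∷ (X (ones m) ∷ []) ∷ [] ∷ ones v ∷ ones p ∷ ones r ∷ []) 3 1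
  exec-ask x v p r m = ask (branch (X (ones m)))
    where
    branch : ∀ b → Exec X (if b then push 3F true else push 3F false) (scanning x 0 v (p , r , m))
      (x ∷ ones m ∷ [] ∷ (b ∷ []) ∷ [] ∷ ones v ∷ ones p ∷ ones r ∷ []) 2 0
    branch true  = push
    branch false = push

  exec-compose : ∀ e x c v p r m → m ≤ v → Exec X (compose e)
    (x ∷ ones m ∷ [] ∷ (c ∷ []) ∷ [] ∷ ones v ∷ ones p ∷ ones r ∷ [])
    ([] ∷ request c v e (reverse (reverse x)) ∷ [] ∷ [] ∷ [] ∷ [] ∷ ones p ∷ ones r ∷ [])
    (composeCost e v (length x)) 0
  exec-compose e x c v p r m m≤v =
    exec-repeat≤ (λ i _ → state x (ones i) [] (c ∷ []) v) 0 (λ _ _ → refl) m≤v (λ _ _ _ → skip) ⨾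
    exec-while (λ w d → state w [] d (c ∷ []) v) 2 (λ _ _ → refl) x (λ _ _ _ _ → push) ⨾
    within (≤-reflexive (cong (λ n → 1 + n * 3) (length-reverse x)))
      (exec-while (λ w d → state [] d w (c ∷ []) v) 2 (λ _ _ → refl) (reverse x) (λ _ _ _ _ → push)) ⨾
    push ⨾
    exec-pushes (λ d → state [] (unary d y) [] (c ∷ []) v) (λ _ → refl) e ⨾
    push ⨾
    exec-repeat (λ i d → state [] (unary d (unary e y)) [] (c ∷ []) i) 2 (λ _ _ → refl) v (λ _ _ _ → push) ⨾
    exec-while (λ w d → state [] (d ++ unary v (unary e y)) [] w 0) 2 (λ _ _ → refl) (c ∷ []) (λ _ _ _ _ → push)
    where
    y = reverse (reverse x)
    state : Word → Word → Word → Word → ℕ → Stacks 8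
    state i q d b n = i ∷ q ∷ d ∷ b ∷ [] ∷ ones n ∷ ones p ∷ ones r ∷ []

  -- Holds for arbitrary `X`, as the bounds on time and queries must; the first answer changes one
  -- letter of the request and no cost.
  exec-reduction : ∀ k e x → let v = bound k (length x) in
    ∃[ σ ] (Exec X (reduction k e) (x ∷ replicate 7 []) σ (reductionCost k e (length x)) 1 ×
            lookup σ 1F ≡ request (X (ones (cur v))) v e x)
  exec-reduction k e x = _ ,
    (exec-powers x k ⨾
     exec-pushes (λ d → x ∷ [] ∷ [] ∷ ones (d + suc (length x) ^ k) ∷ [] ∷ [] ∷ [] ∷ [] ∷ []) (λ _ → refl) k ⨾
     exec-scan x v ⨾
     exec-ask x v _ _ _ ⨾
     exec-compose e x (X (ones (cur v))) v _ _ _ (cur≤ v)) ,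
    cong (request (X (ones (cur v))) v e) (reverse-involutive x)
    where v = bound k (length x)

-- Polynomial running time of the reduction

module _ where
  private
    infixr 6 _⊕_
    infixr 7 _⊗_
    _⊕_ = polyBounded-+
    _⊗_ = polyBounded-*
    lit = polyBounded-const
    var = polyBounded-id

    power : ∀ k → PolyBounded (λ n → suc n ^ k)
    power = polyBounded-^ (lit 1 ⊕ var)

  multiplyCost-polynomial : ∀ {f} → PolyBounded f → PolyBounded (λ n → multiplyCost n (f n))
  multiplyCost-polynomial F =
    (lit 1 ⊕ var ⊗ (lit 1 ⊕ (lit 2 ⊕ ((lit 1 ⊕ F ⊗ lit 5) ⊕ (lit 1 ⊕ F ⊗ lit 3))))) ⊕
    ((lit 1 ⊕ var ⊗ lit 3) ⊕ (lit 1 ⊕ (var ⊗ F) ⊗ lit 3))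

  powersCost-polynomial : ∀ k → PolyBounded (powersCost k)
  powersCost-polynomial zero    = lit 2
  powersCost-polynomial (suc k) = powersCost-polynomial k ⊕ multiplyCost-polynomial (power k)

  tickCost-polynomial : ∀ {f} → PolyBounded f → PolyBounded (λ n → tickCost (f n))
  tickCost-polynomial F =
    lit 2 ⊕ (lit 1 ⊕ ((lit 1 ⊕ F ⊗ lit 3) ⊕ ((lit 1 ⊕ F ⊗ lit 5) ⊕ (lit 1 ⊕
      ((lit 1 ⊕ F ⊗ lit 1) ⊕ ((lit 1 ⊕ F ⊗ lit 3) ⊕ (lit 1 ⊕ F ⊗ lit 7)))))))

  reductionCost-polynomial : ∀ k e → PolyBounded (λ n → 1 + reductionCost k e n)
  reductionCost-polynomial k e =
    lit 1 ⊕ (powersCost-polynomial k ⊕ (lit (k * 2) ⊕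
      ((lit 1 ⊕ V ⊗ (lit 1 ⊕ tickCost-polynomial V)) ⊕ (lit 3 ⊕
      ((lit 1 ⊕ V ⊗ lit 1) ⊕ ((lit 1 ⊕ var ⊗ lit 3) ⊕ ((lit 1 ⊕ var ⊗ lit 3) ⊕ (lit 2 ⊕ (lit (e * 2) ⊕
      (lit 2 ⊕ ((lit 1 ⊕ V ⊗ lit 3) ⊕ lit 4)))))))))))
    where V = lit k ⊕ power k

-- With the true bit supplied the update changes nothing, but only pointwise; `oracle-local`
-- converts this into equality of oracle answers.
language-request : ∀ β N e x → language β (request (language β (ones (cur N))) N e x) ≡
                               outcome (machineAt 0 e) (oracle β ∷ []) x (2 ^ N)
language-request β N e x = begin
  language β (request c N e x)  ≡⟨ cong (interpret oracle β) (parse-request c N e x) ⟩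
  outcome (machineAt 0 e) (oracle (β [ cur N ≔ c ]) ∷ []) x (2 ^ N)
    ≡⟨ outcome-cong (machineAt 0 e) _ _ x (2 ^ N) (λ { 0F w _ _ →
         oracle-local (length w) w (<⇒≤ (n<2^n (length w))) (λ n _ → unchanged n) }) ⟩
  outcome (machineAt 0 e) (oracle β ∷ []) x (2 ^ N) ∎
  where
  open ≡-Reasoning
  c = language β (ones (cur N))
  unchanged : ∀ n → (β [ cur N ≔ c ]) n ≡ β n
  unchanged n with n ≟ cur N
  ... | yes refl = trans (update-same β n c) (cong (interpret oracle β) (parse-ones n))
  ... | no n≢    = update-other β c n≢

EXP≤language : ∀ β D → D ∈ EXP (oracle β) → D ≤ᴾ₂₋ᵀ language β
EXP≤language β D (M , k , fast , decides) =
  compiled , (proj₁ poly , λ X x → _ , proj₁ (halts X x (proj₂ poly (length x)))) ,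
  (λ X x → proj₂ (halts X x ≤-refl)) ,
  λ x → 1 + reductionCost k e (length x) , trans (proj₁ (halts (language β) x ≤-refl)) (cong halt (correct x))
  where
  -- The index depends on `M` alone, so writing it in unary costs a constant.
  e  = proj₁ (machineAt-covers M 0)
  M≈ = proj₂ (proj₂ (machineAt-covers M 0))
  open Compile (reduction k e)
  poly = reductionCost-polynomial k e

  halts : ∀ X x {f} → 1 + reductionCost k e (length x) ≤ f → let v = bound k (length x) in
    HaltsAt compiled (X ∷ []) x f (X (request (X (ones (cur v))) v e x)) ×
    (∀ t → queryCount compiled (X ∷ []) x t ≤ 2)
  halts X x {f} h with exec-reduction {X} k e x
  ... | σ , d , q≡ = subst
    (λ q → HaltsAt compiled (X ∷ []) x f (X q) × (∀ t → queryCount compiled (X ∷ []) x t ≤ 2)) q≡ (compiled-halts X x d h)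

  correct : ∀ x → let v = bound k (length x) in
    language β (request (language β (ones (cur v))) v e x) ≡ D x
  correct x = begin
    language β (request (language β (ones (cur v))) v e x) ≡⟨ language-request β v e x ⟩
    outcome (machineAt 0 e) (oracle β ∷ []) x (2 ^ v)      ≡⟨ outcome-≈ M≈ (oracle β ∷ []) x (2 ^ v) ⟩
    outcome M (oracle β ∷ []) x (2 ^ v)                    ≡⟨ halts⇒outcome M (oracle β ∷ []) x T (2 ^ v) T≤ (proj₂ (fast x)) ⟩
    proj₁ (fast x)                                         ≡⟨ halts⇒outcome M (oracle β ∷ []) x T T ≤-refl (proj₂ (fast x)) ⟨
    outcome M (oracle β ∷ []) x T                          ≡⟨ decided-outcome M (oracle β ∷ []) x T (proj₁ (decides x)) (proj₂ (fast x)) (proj₂ (decides x)) ⟩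
    D x                                                    ∎
    where
    open ≡-Reasoning
    v = bound k (length x)
    T = expBound k (length x)
    T≤ : T ≤ 2 ^ v
    T≤ = ^-monoʳ-≤ 2 (≤-trans (≤-reflexive (+-comm (length x ^ k) k))
                              (+-monoʳ-≤ k (^-monoˡ-≤ k (n≤1+n (length x)))))

theorem4p2 : ∃[ B ] ∃[ A ] (Complete₂₋ᵀ A (EXP B) × ¬ AutoreducibleRelativeTo B A)
theorem4p2 = oracle limit , language limit , (language∈EXP limit , EXP≤language limit) , ¬autoreducible
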